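{- For all nonnegative integers $n,m,k$, $$\det\left(q^{\binom{i-j+m}{2}}\begin{bmatrix}k+i+j+m\\ i-j+m\end{bmatrix}\right)_{i,j=0}^{n-1}=q^{n\binom{m}{2}}\prod_{j=1}^{n}\frac{\prod_{\ell=0}^{2m-1}[2j-1+k+\ell]}{\prod_{\ell=0}^{m-1}[j+\ell]\,[j+k+m+\ell]}=\det\left(C_{n-i+j}^{(2i+k+1)}(q)\right)_{i,j=0}^{m-1}.$$
   Context: $q$ is an indeterminate, $[a]=\frac{1-q^a}{1-q}$, $(q;q)_a=\prod_{l=1}^a(1-q^l)$, and for integers $a\ge0$, $b$, $\begin{bmatrix}a\\ b\end{bmatrix}=\frac{(q;q)_a}{(q;q)_b(q;q)_{a-b}}$ if $0\le b\le a$ and $0$ otherwise; $\binom{a}{2}=a(a-1)/2$ for any integer $a$. For a positive integer $r$ and integer $\ell$, $C_\ell^{(r)}(q)=\frac{[r]}{[2\ell+r]}\begin{bmatrix}2\ell+r\\ \ell\end{bmatrix}$ if $\ell\ge0$ and $C_\ell^{(r)}(q)=0$ if $\ell<0$. Empty products and $0\times0$ determinants equal $1$. -}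

module Defs where

open import Level using (Level; _⊔_) renaming (suc to lsuc)
open import Algebra.Bundles using (CommutativeRing)
open import Relation.Nullary using (¬_)
open import Data.Nat as ℕ using (ℕ; zero; suc; _≤?_)
open import Data.Nat.Combinatorics using (_C_)
open import Data.Integer as ℤ using (ℤ; +_; -[1+_])
open import Data.Fin using (Fin; toℕ; punchIn)
import Data.Fin as Fin
open import Relation.Nullary using (yes; no)

-- A field: a commutative ring with 0 ≠ 1 and an inverse for every nonzero
-- element (the inverse operation is total; its value at 0 is irrelevant).
record Field c ℓ : Set (lsuc (c ⊔ ℓ)) where
  field
    commutativeRing : CommutativeRing c ℓ
  open CommutativeRing commutativeRing public
  field
    _⁻¹        : Carrier → Carrier
    ⁻¹-cong    : ∀ {x y} → x ≈ y → x ⁻¹ ≈ y ⁻¹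
    0≉1        : ¬ (0# ≈ 1#)
    ⁻¹-inverse : ∀ x → ¬ (x ≈ 0#) → x * x ⁻¹ ≈ 1#

-- binom(a,2) = a(a-1)/2 for an integer a (always a natural number)
binom2 : ℤ → ℕ
binom2 (+ n)     = n C 2
binom2 -[1+ n ]  = (suc (suc n)) C 2      -- (-(n+1))(-(n+2))/2

module QDefs {c ℓ} (F : Field c ℓ) (q : Field.Carrier F) where
  open Field F

  pow : Carrier → ℕ → Carrier
  pow x zero    = 1#
  pow x (suc n) = x * pow x n

  prod : ℕ → (ℕ → Carrier) → Carrier
  prod zero    f = 1#
  prod (suc n) f = prod n f * f n

  sumFin : ∀ n → (Fin n → Carrier) → Carrier
  sumFin zero    f = 0#
  sumFin (suc n) f = f Fin.zero + sumFin n (λ j → f (Fin.suc j))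

  alt : ℕ → Carrier → Carrier
  alt zero    x = x
  alt (suc j) x = - alt j x

  det : ∀ n → (Fin n → Fin n → Carrier) → Carrier
  det zero    M = 1#
  det (suc n) M = sumFin (suc n) λ j →
    alt (toℕ j) (M Fin.zero j * det n (λ a b → M (Fin.suc a) (punchIn j b)))

  qint : ℕ → Carrier
  qint a = (1# - pow q a) * (1# - q) ⁻¹

  qpoch : ℕ → Carrier
  qpoch a = prod a (λ l → 1# - pow q (suc l))

  qbinom : ℕ → ℤ → Carrier
  qbinom a -[1+ b ] = 0#
  qbinom a (+ b) with b ≤? a
  ... | yes _ = qpoch a * (qpoch b * qpoch (a ℕ.∸ b)) ⁻¹
  ... | no  _ = 0#

  qC : ℤ → ℕ → Carrier
  qC -[1+ l ] r = 0#
  qC (+ l) r = qint r * qint (2 ℕ.* l ℕ.+ r) ⁻¹ * qbinom (2 ℕ.* l ℕ.+ r) (+ l)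

  NotRootOfUnity : Set ℓ
  NotRootOfUnity = ∀ a → ¬ (pow q (suc a) ≈ 1#)

  lhsDet : ℕ → ℕ → ℕ → Carrier
  lhsDet n m k = det n λ i j →
    pow q (binom2 ((+ toℕ i) ℤ.- (+ toℕ j) ℤ.+ (+ m)))
      * qbinom (k ℕ.+ toℕ i ℕ.+ toℕ j ℕ.+ m) ((+ toℕ i) ℤ.- (+ toℕ j) ℤ.+ (+ m))

  middle : ℕ → ℕ → ℕ → Carrier
  middle n m k = pow q (n ℕ.* (m C 2)) * prod n λ j' →
    let j = suc j' in
    prod (2 ℕ.* m) (λ l → qint (2 ℕ.* j ℕ.∸ 1 ℕ.+ k ℕ.+ l))
      * (prod m (λ l → qint (j ℕ.+ l) * qint (j ℕ.+ k ℕ.+ m ℕ.+ l))) ⁻¹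

  rhsDet : ℕ → ℕ → ℕ → Carrier
  rhsDet n m k = det m λ i j →
    qC ((+ n) ℤ.- (+ toℕ i) ℤ.+ (+ toℕ j)) (2 ℕ.* toℕ i ℕ.+ k ℕ.+ 1)

{-# OPTIONS --safe --termination-depth=2 #-}
module Submission where

-- Both determinants are evaluated by eliminating with neighbouring lines.
-- Subtracting from each row of the left matrix a multiple of the previous row,
-- so as to clear the first column, leaves up to row and column factors the same
-- matrix for (n - 1, m, k + 1).  Subtracting from each column of the right matrix
-- a multiple of the previous column, so as to clear the first row, leaves up to
-- such factors the matrix for (n, m - 1, k + 2) with entries scaled by q^(n-i+j).
-- The product in the middle satisfies both recurrences.  As q = 0 is allowed and
-- equality is not decidable, all steps avoid dividing by q.

open import Defs
open import Data.Nat using (ℕ)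
open import Data.Product using (_×_)

import Algebra.Solver.CommutativeMonoid
import Algebra.Solver.Ring.NaturalCoefficients.Default
open import Data.Fin using (Fin; toℕ; punchIn)
import Data.Fin as Fin
open import Data.Integer as ℤ using (+_; -[1+_]; _⊖_)
import Data.Integer.Properties as ℤ
open import Data.Nat as ℕ using (zero; suc; _<_; _≤?_)
open import Data.Nat.Combinatorics using (_C_; nC1≡n; nCk+nC[k+1]≡[n+1]C[k+1])
import Data.Nat.Properties as ℕ
open import Data.Nat.Tactic.RingSolver using (solve-∀)
open import Data.Product using (_,_; ∃)
open import Relation.Binary.PropositionalEquality as ≡ using (_≡_)
open import Relation.Nullary using (¬_; yes; no; contradiction)

-- Neighbouring lines suffice because every entry is a product of q-factorials `P` and inverses of
-- such, so that neighbouring entries differ by a few factors 1 - q^a. Once the common factors are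
-- pulled out, each elimination is one quadratic identity with two terms on its right side: one is
-- the multiple of the previous line, the other splits into a row factor, a column factor and an
-- entry with shifted parameters. The delicate point is the truncation of entries to 0 at negative
-- index. It agrees with the identities because the term that has to vanish on the border carries
-- `u 0`, which is 0. Splitting q^(n-i+j) into row and column factors would need negative powers of
-- q. The right matrices therefore form a family with an extra parameter `y`, which each elimination
-- multiplies by q.

module Determinant {c ℓ} (F : Field c ℓ) (q : Field.Carrier F) where
  open Field F
  open QDefs F q
  open import Algebra.Properties.Ring ring
    using (-‿distribˡ-*; -‿+-comm; -0#≈0#)
  open import Algebra.Properties.CommutativeSemigroup +-commutativeSemigroup
    using () renaming (interchange to +-interchange)
  open import Algebra.Properties.CommutativeSemigroup *-commutativeSemigroup
    using (x∙yz≈y∙xz) renaming (interchange to *-interchange)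
  open Algebra.Solver.CommutativeMonoid *-commutativeMonoid using (solve; _⊕_; _⊜_)
  open import Relation.Binary.Reasoning.Setoid setoid

  -- Finite sums and alternating signs.

  sum-cong : ∀ n (f g : Fin n → Carrier) → (∀ i → f i ≈ g i) →
             sumFin n f ≈ sumFin n g
  sum-cong zero    f g e = refl
  sum-cong (suc n) f g e = +-cong (e Fin.zero) (sum-cong n _ _ (λ j → e (Fin.suc j)))

  sum-zero : ∀ n (f : Fin n → Carrier) → (∀ i → f i ≈ 0#) → sumFin n f ≈ 0#
  sum-zero zero    f e = refl
  sum-zero (suc n) f e =
    trans (+-cong (e Fin.zero) (sum-zero n _ (λ j → e (Fin.suc j)))) (+-identityˡ 0#)

  sum-+ : ∀ n (f g : Fin n → Carrier) →
          sumFin n (λ i → f i + g i) ≈ sumFin n f + sumFin n g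
  sum-+ zero    f g = sym (+-identityˡ 0#)
  sum-+ (suc n) f g = trans (+-congˡ (sum-+ n _ _)) (+-interchange _ _ _ _)

  sum-*ˡ : ∀ n x (f : Fin n → Carrier) →
           sumFin n (λ i → x * f i) ≈ x * sumFin n f
  sum-*ˡ zero    x f = sym (zeroʳ x)
  sum-*ˡ (suc n) x f = trans (+-congˡ (sum-*ˡ n x _)) (sym (distribˡ x _ _))

  sum-swap : ∀ m n (f : Fin m → Fin n → Carrier) →
             sumFin m (λ i → sumFin n (f i)) ≈ sumFin n (λ j → sumFin m (λ i → f i j))
  sum-swap zero    n f = sym (sum-zero n _ (λ _ → refl))
  sum-swap (suc m) n f =
    trans (+-congˡ (sum-swap m n _)) (sym (sum-+ n _ _))

  alt-* : ∀ j x → alt j x ≈ alt j 1# * x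
  alt-* zero    x = sym (*-identityˡ x)
  alt-* (suc j) x = trans (-‿cong (alt-* j x)) (-‿distribˡ-* (alt j 1#) x)

  alt-cong : ∀ j {x y} → x ≈ y → alt j x ≈ alt j y
  alt-cong zero    e = e
  alt-cong (suc j) e = -‿cong (alt-cong j e)

  alt-zero : ∀ j {x} → x ≈ 0# → alt j x ≈ 0#
  alt-zero zero    e = e
  alt-zero (suc j) e = trans (-‿cong (alt-zero j e)) -0#≈0#

  alt-+ : ∀ j x y → alt j (x + y) ≈ alt j x + alt j y
  alt-+ zero    x y = refl
  alt-+ (suc j) x y = trans (-‿cong (alt-+ j x y)) (sym (-‿+-comm _ _))

  alt-*ˡ : ∀ j x y → alt j (x * y) ≈ x * alt j y
  alt-*ˡ j x y = begin
    alt j (x * y)       ≈⟨ alt-* j (x * y) ⟩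
    alt j 1# * (x * y)  ≈⟨ x∙yz≈y∙xz _ _ _ ⟩
    x * (alt j 1# * y)  ≈⟨ *-congˡ (alt-* j y) ⟨
    x * alt j y         ∎

  -- Determinants: transposition and vanishing.

  Matrix : ℕ → Set c
  Matrix n = Fin n → Fin n → Carrier

  minor : ∀ {n} → Matrix (suc n) → Fin (suc n) → Matrix n
  minor M j a b = M (Fin.suc a) (punchIn j b)

  laplace : ∀ {n} → Matrix (suc n) → Fin (suc n) → Carrier
  laplace {n} M j = alt (toℕ j) (M Fin.zero j * det n (minor M j))

  det-cong : ∀ n {M N : Matrix n} → (∀ i j → M i j ≈ N i j) → det n M ≈ det n N
  det-cong zero            e = refl
  det-cong (suc n) {M} {N} e = sum-cong (suc n) (laplace M) (laplace N) λ j →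
    alt-cong (toℕ j) (*-cong (e Fin.zero j)
      (det-cong n (λ a b → e (Fin.suc a) (punchIn j b))))

  -- Expanding along the first row, and then the minors along their first
  -- column, gives an expression that is symmetric under transposition.
  det-transpose : ∀ n (M : Matrix n) → det n (λ i j → M j i) ≈ det n M
  det-transpose zero          M = refl
  det-transpose (suc zero)    M = refl
  det-transpose (suc (suc n)) M = +-cong
    (*-congˡ (det-transpose (suc n) (minor M Fin.zero)))
    (begin
      sumFin (suc n) (λ j → laplace Mᵀ (Fin.suc j))
        ≈⟨ sum-cong (suc n) _ (λ j → sumFin (suc n) (term j)) expandColumn ⟩
      sumFin (suc n) (λ j → sumFin (suc n) (term j))
        ≈⟨ sum-swap (suc n) (suc n) term ⟩
      sumFin (suc n) (λ i → sumFin (suc n) (λ j → term j i))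
        ≈⟨ sum-cong (suc n) (λ i → laplace M (Fin.suc i)) _ expandRow ⟨
      sumFin (suc n) (λ i → laplace M (Fin.suc i)) ∎)
    where
    Mᵀ : Matrix (suc (suc n))
    Mᵀ i j = M j i

    core : Fin (suc n) → Fin (suc n) → Matrix n
    core j i a b = M (Fin.suc (punchIn j a)) (Fin.suc (punchIn i b))

    row column : Fin (suc n) → Carrier
    row i    = M Fin.zero (Fin.suc i)
    column j = M (Fin.suc j) Fin.zero

    term : Fin (suc n) → Fin (suc n) → Carrier
    -- Both indices are counted without the corner, so one of the two successive expansions sees its
    -- index raised by one; hence the minus sign.
    term j i = - (alt (toℕ j) 1# * alt (toℕ i) 1#) * (column j * row i * det n (core j i))

    regroup : ∀ k l x y d →
      - (alt k 1# * alt l 1#) * (x * y * d) ≈ alt (suc k) 1# * (x * alt l (y * d))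
    regroup k l x y d = begin
      - (alt k 1# * alt l 1#) * (x * y * d)
        ≈⟨ *-congʳ (-‿distribˡ-* (alt k 1#) (alt l 1#)) ⟩
      - alt k 1# * alt l 1# * (x * y * d)
        ≈⟨ solve 5 (λ s t x y d → (s ⊕ t) ⊕ ((x ⊕ y) ⊕ d) ⊜ s ⊕ (x ⊕ (t ⊕ (y ⊕ d))))
             refl (- alt k 1#) (alt l 1#) x y d ⟩
      - alt k 1# * (x * (alt l 1# * (y * d)))
        ≈⟨ *-congˡ (*-congˡ (alt-* l (y * d))) ⟨
      - alt k 1# * (x * alt l (y * d)) ∎

    expandColumn : ∀ j → laplace Mᵀ (Fin.suc j) ≈ sumFin (suc n) (term j)
    expandColumn j = begin
      laplace Mᵀ (Fin.suc j)
        ≈⟨ alt-* (suc (toℕ j)) _ ⟩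
      σ * (column j * det (suc n) (minor Mᵀ (Fin.suc j)))
        ≈⟨ *-congˡ (*-congˡ (det-transpose (suc n) (λ b a → minor Mᵀ (Fin.suc j) a b))) ⟩
      σ * (column j * sumFin (suc n) inner)
        ≈⟨ *-congˡ (sum-*ˡ (suc n) (column j) inner) ⟨
      σ * sumFin (suc n) (λ i → column j * inner i)
        ≈⟨ sum-*ˡ (suc n) σ (λ i → column j * inner i) ⟨
      sumFin (suc n) (λ i → σ * (column j * inner i))
        ≈⟨ sum-cong (suc n) _ (term j) (λ i →
             sym (regroup (toℕ j) (toℕ i) (column j) (row i) (det n (core j i)))) ⟩
      sumFin (suc n) (term j) ∎
      where
      σ = alt (suc (toℕ j)) 1#

      inner : Fin (suc n) → Carrier
      inner i = alt (toℕ i) (row i * det n (core j i))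

    expandRow : ∀ i → laplace M (Fin.suc i) ≈ sumFin (suc n) (λ j → term j i)
    expandRow i = begin
      laplace M (Fin.suc i)
        ≈⟨ alt-* (suc (toℕ i)) _ ⟩
      σ * (row i * det (suc n) (minor M (Fin.suc i)))
        ≈⟨ *-congˡ (*-congˡ (det-transpose (suc n) (minor M (Fin.suc i)))) ⟨
      σ * (row i * sumFin (suc n) inner)
        ≈⟨ *-congˡ (sum-*ˡ (suc n) (row i) inner) ⟨
      σ * sumFin (suc n) (λ j → row i * inner j)
        ≈⟨ sum-*ˡ (suc n) σ (λ j → row i * inner j) ⟨
      sumFin (suc n) (λ j → σ * (row i * inner j))
        ≈⟨ sum-cong (suc n) _ (λ j → term j i) (λ j → trans
             (sym (regroup (toℕ i) (toℕ j) (row i) (column j)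
               (det n (λ a b → core j i b a))))
             (*-cong (-‿cong (*-comm _ _))
               (*-cong (*-comm _ _) (det-transpose n (core j i))))) ⟩
      sumFin (suc n) (λ j → term j i) ∎
      where
      σ = alt (suc (toℕ i)) 1#

      inner : Fin (suc n) → Carrier
      inner j = alt (toℕ j) (column j * det n (λ a b → core j i b a))

  laplace-zero : ∀ n (M : Matrix (suc n)) j → det n (minor M j) ≈ 0# → laplace M j ≈ 0#
  laplace-zero n M j e = alt-zero (toℕ j) (trans (*-congˡ e) (zeroʳ (M Fin.zero j)))

  det-zeroColumn : ∀ n (M : Matrix (suc n)) → (∀ i → M i Fin.zero ≈ 0#) →
                   det (suc n) M ≈ 0#
  det-zeroColumn n M e = sum-zero (suc n) (laplace M) (vanish n M e)
    where
    vanish : ∀ n (M : Matrix (suc n)) → (∀ i → M i Fin.zero ≈ 0#) → ∀ j → laplace M j ≈ 0#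
    vanish n       M e Fin.zero    =
      trans (*-congʳ (e Fin.zero)) (zeroˡ (det n (minor M Fin.zero)))
    vanish (suc n) M e (Fin.suc j) = laplace-zero (suc n) M (Fin.suc j)
      (det-zeroColumn n (minor M (Fin.suc j)) (λ i → e (Fin.suc i)))

  -- The first two Laplace terms have equal minors and opposite signs. Every later minor keeps both
  -- columns in front, so induction applies to it.
  det-equalColumns : ∀ n (M : Matrix (suc (suc n))) →
                     (∀ i → M i Fin.zero ≈ M i (Fin.suc Fin.zero)) →
                     det (suc (suc n)) M ≈ 0#
  det-equalColumns n M e = begin
    x + (- y + rest) ≈⟨ +-assoc x (- y) rest ⟨
    x - y + rest     ≈⟨ +-cong cancel (sum-zero n _ (vanish n M e)) ⟩
    0# + 0#          ≈⟨ +-identityˡ 0# ⟩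
    0#               ∎
    where
    x    = M Fin.zero Fin.zero * det (suc n) (minor M Fin.zero)
    y    = M Fin.zero (Fin.suc Fin.zero) * det (suc n) (minor M (Fin.suc Fin.zero))
    rest = sumFin n (λ j → laplace M (Fin.suc (Fin.suc j)))

    sameMinor : ∀ a b → minor M Fin.zero a b ≈ minor M (Fin.suc Fin.zero) a b
    sameMinor a Fin.zero    = sym (e (Fin.suc a))
    sameMinor a (Fin.suc b) = refl

    cancel : x - y ≈ 0#
    cancel = trans (+-congʳ (*-cong (e Fin.zero) (det-cong (suc n) sameMinor)))
                   (-‿inverseʳ y)

    vanish : ∀ n (M : Matrix (suc (suc n))) → (∀ i → M i Fin.zero ≈ M i (Fin.suc Fin.zero)) →
             ∀ j → laplace M (Fin.suc (Fin.suc j)) ≈ 0#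
    vanish (suc n) M e j = laplace-zero (suc (suc n)) M (Fin.suc (Fin.suc j))
      (det-equalColumns n (minor M (Fin.suc (Fin.suc j))) (λ i → e (Fin.suc i)))

  det-equalRows : ∀ n (M : Matrix (suc (suc n))) →
                  (∀ j → M Fin.zero j ≈ M (Fin.suc Fin.zero) j) →
                  det (suc (suc n)) M ≈ 0#
  det-equalRows n M e = trans (sym (det-transpose (suc (suc n)) M))
    (det-equalColumns n (λ i j → M j i) e)

  det-clearedColumn : ∀ n (M : Matrix (suc n)) → (∀ i → M (Fin.suc i) Fin.zero ≈ 0#) →
    det (suc n) M ≈ M Fin.zero Fin.zero * det n (minor M Fin.zero)
  det-clearedColumn n M e =
    trans (+-congˡ (sum-zero n (λ j → laplace M (Fin.suc j)) (vanish n M e))) (+-identityʳ _)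
    where
    vanish : ∀ n (M : Matrix (suc n)) → (∀ i → M (Fin.suc i) Fin.zero ≈ 0#) →
             ∀ j → laplace M (Fin.suc j) ≈ 0#
    vanish (suc n) M e j =
      laplace-zero (suc n) M (Fin.suc j) (det-zeroColumn n (minor M (Fin.suc j)) e)

  -- Row operations, scaling and the elimination step.

  Rows : ℕ → Set c
  Rows n = ℕ → Fin n → Carrier

  detRows : ∀ n → Rows n → Carrier
  detRows n M = det n (λ i → M (toℕ i))

  -- With rows indexed by ℕ, the minors of `r ◂ M` reduce to rows of `M` by computation.
  _◂_ : ∀ {n} → (Fin n → Carrier) → Rows n → Rows n
  (r ◂ M) zero    = r
  (r ◂ M) (suc i) = M i

  sum-linear : ∀ n s (f g h : Fin n → Carrier) → (∀ j → f j ≈ s * g j + h j) →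
               sumFin n f ≈ s * sumFin n g + sumFin n h
  sum-linear n s f g h e = begin
    sumFin n f                               ≈⟨ sum-cong n f _ e ⟩
    sumFin n (λ j → s * g j + h j)           ≈⟨ sum-+ n _ h ⟩
    sumFin n (λ j → s * g j) + sumFin n h    ≈⟨ +-congʳ (sum-*ˡ n s g) ⟩
    s * sumFin n g + sumFin n h              ∎

  alt-linear : ∀ j s x y → alt j (s * x + y) ≈ s * alt j x + alt j y
  alt-linear j s x y = trans (alt-+ j (s * x) y) (+-congʳ (alt-*ˡ j s x))

  det-firstRow-linear : ∀ n (x y z : Fin (suc n) → Carrier) (T : Rows (suc n)) s →
    (∀ j → x j ≈ s * y j + z j) →
    detRows (suc n) (x ◂ T) ≈ s * detRows (suc n) (y ◂ T) + detRows (suc n) (z ◂ T)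
  det-firstRow-linear n x y z T s e =
    sum-linear (suc n) s (λ j → alt (toℕ j) (x j * d j)) (λ j → alt (toℕ j) (y j * d j))
      (λ j → alt (toℕ j) (z j * d j)) λ j → begin
        alt (toℕ j) (x j * d j)
          ≈⟨ alt-cong (toℕ j) (trans (*-congʳ (e j)) (distribʳ (d j) _ _)) ⟩
        alt (toℕ j) (s * y j * d j + z j * d j)
          ≈⟨ alt-cong (toℕ j) (+-congʳ (*-assoc s _ _)) ⟩
        alt (toℕ j) (s * (y j * d j) + z j * d j)
          ≈⟨ alt-linear (toℕ j) s _ _ ⟩
        s * alt (toℕ j) (y j * d j) + alt (toℕ j) (z j * d j) ∎
    where
    d : Fin (suc n) → Carrier
    d j = detRows n (λ i b → T i (punchIn j b))

  det-secondRow-linear : ∀ n (r x y z : Fin (suc (suc n)) → Carrier) (T : Rows (suc (suc n))) s →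
    (∀ j → x j ≈ s * y j + z j) →
    detRows (suc (suc n)) (r ◂ (x ◂ T))
      ≈ s * detRows (suc (suc n)) (r ◂ (y ◂ T)) + detRows (suc (suc n)) (r ◂ (z ◂ T))
  det-secondRow-linear n r x y z T s e =
    sum-linear (suc (suc n)) s (λ j → alt (toℕ j) (r j * d x j))
      (λ j → alt (toℕ j) (r j * d y j)) (λ j → alt (toℕ j) (r j * d z j)) λ j → begin
        alt (toℕ j) (r j * d x j)
          ≈⟨ alt-cong (toℕ j) (*-congˡ (linear j)) ⟩
        alt (toℕ j) (r j * (s * d y j + d z j))
          ≈⟨ alt-cong (toℕ j) (trans (distribˡ _ _ _) (+-congʳ (x∙yz≈y∙xz _ _ _))) ⟩
        alt (toℕ j) (s * (r j * d y j) + r j * d z j)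
          ≈⟨ alt-linear (toℕ j) s _ _ ⟩
        s * alt (toℕ j) (r j * d y j) + alt (toℕ j) (r j * d z j) ∎
    where
    d : (Fin (suc (suc n)) → Carrier) → Fin (suc (suc n)) → Carrier
    d w j = detRows (suc n) ((λ b → w (punchIn j b)) ◂ (λ i b → T i (punchIn j b)))

    linear : ∀ j → d x j ≈ s * d y j + d z j
    linear j = det-firstRow-linear n (λ b → x (punchIn j b)) (λ b → y (punchIn j b))
      (λ b → z (punchIn j b)) (λ i b → T i (punchIn j b)) s (λ b → e (punchIn j b))

  -- What is subtracted is a multiple of the original row `M i`, so the rows have to be replaced
  -- from the bottom up. Expanding along row 0 lets induction treat the rows from 2 on inside the
  -- minors while row 1 is still intact; then row 1 is split by linearity, and the part that repeats
  -- row 0 vanishes.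
  det-subtractRows : ∀ n (M N : Rows n) (s : ℕ → Carrier) →
    (∀ j → M 0 j ≈ N 0 j) →
    (∀ i j → M (suc i) j ≈ s i * M i j + N (suc i) j) →
    detRows n M ≈ detRows n N
  det-subtractRows zero          M N s e₀ e = refl
  det-subtractRows (suc zero)    M N s e₀ e = +-congʳ (*-congʳ (e₀ Fin.zero))
  det-subtractRows (suc (suc n)) M N s e₀ e = begin
    detRows (2 ℕ.+ n) M
      ≈⟨ sum-cong (2 ℕ.+ n) (laplace (λ i → M (toℕ i)))
           (laplace (λ i → (M 0 ◂ (M 1 ◂ N₂)) (toℕ i)))
           (λ j → alt-cong (toℕ j) (*-congˡ (subtract j))) ⟩
    detRows (2 ℕ.+ n) (M 0 ◂ (M 1 ◂ N₂))
      ≈⟨ det-secondRow-linear n (M 0) (M 1) (M 0) (N 1) N₂ (s 0) (e 0) ⟩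
    s 0 * detRows (2 ℕ.+ n) (M 0 ◂ (M 0 ◂ N₂)) + detRows (2 ℕ.+ n) (M 0 ◂ (N 1 ◂ N₂))
      ≈⟨ +-cong (trans
           (*-congˡ (det-equalRows n (λ i → (M 0 ◂ (M 0 ◂ N₂)) (toℕ i)) (λ _ → refl)))
           (zeroʳ (s 0)))
           (det-cong (2 ℕ.+ n) {λ i → (M 0 ◂ (N 1 ◂ N₂)) (toℕ i)} {λ i → N (toℕ i)} rows) ⟩
    0# + detRows (2 ℕ.+ n) N ≈⟨ +-identityˡ _ ⟩
    detRows (2 ℕ.+ n) N ∎
    where
    N₂ : Rows (2 ℕ.+ n)
    N₂ i = N (2 ℕ.+ i)

    subtract : ∀ j → detRows (suc n) (λ i b → M (suc i) (punchIn j b))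
                   ≈ detRows (suc n) (λ i b → (M 1 ◂ N₂) i (punchIn j b))
    subtract j = det-subtractRows (suc n) (λ i b → M (suc i) (punchIn j b))
      (λ i b → (M 1 ◂ N₂) i (punchIn j b)) (λ i → s (suc i)) (λ _ → refl)
      (λ i b → e (suc i) (punchIn j b))

    rows : ∀ i j → (M 0 ◂ (N 1 ◂ N₂)) (toℕ {2 ℕ.+ n} i) j ≈ N (toℕ i) j
    rows Fin.zero              j = e₀ j
    rows (Fin.suc Fin.zero)    j = refl
    rows (Fin.suc (Fin.suc i)) j = refl

  prod-cong : ∀ n {f g : ℕ → Carrier} → (∀ i → f i ≈ g i) → prod n f ≈ prod n g
  prod-cong zero    e = refl
  prod-cong (suc n) e = *-cong (prod-cong n e) (e n)

  prod-* : ∀ n (f g : ℕ → Carrier) → prod n (λ i → f i * g i) ≈ prod n f * prod n g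
  prod-* zero    f g = sym (*-identityˡ 1#)
  prod-* (suc n) f g = trans (*-congʳ (prod-* n f g)) (*-interchange _ _ _ _)

  prod-front : ∀ n (f : ℕ → Carrier) → prod (suc n) f ≈ f 0 * prod n (λ i → f (suc i))
  prod-front zero    f = *-comm 1# (f 0)
  prod-front (suc n) f = trans (*-congʳ (prod-front n f)) (*-assoc _ _ _)

  det-scaleRows : ∀ n (r : ℕ → Carrier) (M : Matrix n) →
    det n (λ i j → r (toℕ i) * M i j) ≈ prod n r * det n M
  det-scaleRows zero    r M = sym (*-identityˡ 1#)
  det-scaleRows (suc n) r M = begin
    det (suc n) rM
      ≈⟨ sum-cong (suc n) (laplace rM) (λ j → r 0 * ρ * laplace M j) (λ j → begin
           alt (toℕ j) (r 0 * M Fin.zero j * det n (minor rM j))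
             ≈⟨ alt-cong (toℕ j) (*-congˡ (det-scaleRows n (λ i → r (suc i)) (minor M j))) ⟩
           alt (toℕ j) (r 0 * M Fin.zero j * (ρ * det n (minor M j)))
             ≈⟨ alt-cong (toℕ j) (*-interchange _ _ _ _) ⟩
           alt (toℕ j) (r 0 * ρ * (M Fin.zero j * det n (minor M j)))
             ≈⟨ alt-*ˡ (toℕ j) _ _ ⟩
           r 0 * ρ * laplace M j ∎) ⟩
    sumFin (suc n) (λ j → r 0 * ρ * laplace M j)
      ≈⟨ sum-*ˡ (suc n) (r 0 * ρ) (laplace M) ⟩
    r 0 * ρ * det (suc n) M
      ≈⟨ *-congʳ (prod-front n r) ⟨
    prod (suc n) r * det (suc n) M ∎
    where
    ρ = prod n (λ i → r (suc i))

    rM : Matrix (suc n)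
    rM i j = r (toℕ i) * M i j

  det-scaleColumns : ∀ n (t : ℕ → Carrier) (M : Matrix n) →
    det n (λ i j → t (toℕ j) * M i j) ≈ prod n t * det n M
  det-scaleColumns n t M = begin
    det n (λ i j → t (toℕ j) * M i j) ≈⟨ det-transpose n (λ i j → t (toℕ j) * M i j) ⟨
    det n (λ j i → t (toℕ j) * M i j) ≈⟨ det-scaleRows n t (λ j i → M i j) ⟩
    prod n t * det n (λ j i → M i j)  ≈⟨ *-congˡ (det-transpose n M) ⟩
    prod n t * det n M                ∎

  detℕ : ℕ → (ℕ → ℕ → Carrier) → Carrier
  detℕ n M = det n (λ i j → M (toℕ i) (toℕ j))

  -- The multipliers `s` are supplied and the equations are additive, so no pivot is inverted:
  -- `M 0 0` may be 0, as happens in the left matrix for q = 0 and m at least 2.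
  det-eliminate : ∀ n (M M′ : ℕ → ℕ → Carrier) (s r t : ℕ → Carrier) →
    (∀ i → M (suc i) 0 ≈ s i * M i 0) →
    (∀ i j → M (suc i) (suc j) ≈ s i * M i (suc j) + r i * t j * M′ i j) →
    detℕ (suc n) M ≈ M 0 0 * (prod n r * prod n t * detℕ n M′)
  det-eliminate n M M′ s r t e₀ e = begin
    detℕ (suc n) M
      ≈⟨ det-subtractRows (suc n) (λ i j → M i (toℕ j)) (λ i j → N i (toℕ j)) s
           (λ _ → refl) (λ i j → step i (toℕ j)) ⟩
    detℕ (suc n) N
      ≈⟨ det-clearedColumn n (λ i j → N (toℕ i) (toℕ j)) (λ _ → refl) ⟩
    M 0 0 * det n (λ i j → r (toℕ i) * t (toℕ j) * M′ (toℕ i) (toℕ j))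
      ≈⟨ *-congˡ (begin
           det n (λ i j → r (toℕ i) * t (toℕ j) * M′ (toℕ i) (toℕ j))
             ≈⟨ det-cong n (λ _ _ → *-assoc _ _ _) ⟩
           det n (λ i j → r (toℕ i) * (t (toℕ j) * M′ (toℕ i) (toℕ j)))
             ≈⟨ det-scaleRows n r (λ i j → t (toℕ j) * M′ (toℕ i) (toℕ j)) ⟩
           prod n r * det n (λ i j → t (toℕ j) * M′ (toℕ i) (toℕ j))
             ≈⟨ *-congˡ (det-scaleColumns n t (λ i j → M′ (toℕ i) (toℕ j))) ⟩
           prod n r * (prod n t * detℕ n M′)
             ≈⟨ *-assoc _ _ _ ⟨
           prod n r * prod n t * detℕ n M′ ∎) ⟩
    M 0 0 * (prod n r * prod n t * detℕ n M′) ∎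
    where
    N : ℕ → ℕ → Carrier
    N zero    j       = M 0 j
    N (suc i) zero    = 0#
    N (suc i) (suc j) = r i * t j * M′ i j

    step : ∀ i j → M (suc i) j ≈ s i * M i j + N (suc i) j
    step i zero    = trans (e₀ i) (sym (+-identityʳ _))
    step i (suc j) = e i j

module Evaluation {c ℓ} (F : Field c ℓ) (q : Field.Carrier F)
                  (q-generic : QDefs.NotRootOfUnity F q) where
  open Field F
  open QDefs F q
  open Determinant F q
  open import Algebra.Properties.Ring ring
    using (-‿distribʳ-*; x∙y⁻¹≈ε⇒x≈y)
  open import Algebra.Properties.CommutativeSemigroup *-commutativeSemigroup
    using () renaming (interchange to *-interchange)
  open import Relation.Binary.Reasoning.Setoid setoid
  module Products = Algebra.Solver.CommutativeMonoid *-commutativeMonoid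
  module Semiring = Algebra.Solver.Ring.NaturalCoefficients.Default commutativeSemiring
  open Products using (solve; _⊜_; Expr) renaming (id to one)

  -- The factors 1 - q^a, their products, and two quadratic identities.

  infixl 6 _·_
  _·_ : ∀ {n} → Expr n → Expr n → Expr n
  _·_ = Products._⊕_

  -- `R n` is the inverse of `P n`, defined as a product of single inverses so that `P (suc n)` and
  -- `R (suc n)` both unfold to one more factor. Cancellation then concerns pairs `u a * v a` only,
  -- and the rest is rearrangement in a commutative monoid.
  u v P R : ℕ → Carrier
  u a = 1# - pow q a
  v a = u a ⁻¹   -- meaningful for a ≥ 1 only
  P = qpoch
  R n = prod n (λ l → v (suc l))

  u≡ : ∀ {a b} → a ≡ b → u a ≈ u b
  u≡ e = reflexive (≡.cong u e)

  P≡ : ∀ {a b} → a ≡ b → P a ≈ P b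
  P≡ e = reflexive (≡.cong P e)

  R≡ : ∀ {a b} → a ≡ b → R a ≈ R b
  R≡ e = reflexive (≡.cong R e)

  unit-nonzero : ∀ {x y} → x * y ≈ 1# → ¬ (x ≈ 0#)
  unit-nonzero xy≈1 x≈0 = 0≉1 (trans (sym (zeroˡ _)) (trans (*-congʳ (sym x≈0)) xy≈1))

  ⁻¹-unique : ∀ {x y} → x * y ≈ 1# → x ⁻¹ ≈ y
  ⁻¹-unique {x} {y} xy≈1 = begin
    x ⁻¹             ≈⟨ *-identityʳ _ ⟨
    x ⁻¹ * 1#        ≈⟨ *-congˡ xy≈1 ⟨
    x ⁻¹ * (x * y)   ≈⟨ solve 3 (λ x y w → w · (x · y) ⊜ x · w · y) refl x y (x ⁻¹) ⟩
    x * x ⁻¹ * y     ≈⟨ *-congʳ (⁻¹-inverse x (unit-nonzero xy≈1)) ⟩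
    1# * y           ≈⟨ *-identityˡ y ⟩
    y                ∎

  -- Often used from right to left, to insert a pair `u a * v a` whose halves then go to different
  -- places.
  *-cancel : ∀ {x y} z → x * y ≈ 1# → x * y * z ≈ z
  *-cancel z xy≈1 = trans (*-congʳ xy≈1) (*-identityˡ z)

  u*v : ∀ a → u (suc a) * v (suc a) ≈ 1#
  u*v a = ⁻¹-inverse _ λ u≈0 → q-generic a (sym (x∙y⁻¹≈ε⇒x≈y _ _ u≈0))

  P*R : ∀ a → P a * R a ≈ 1#
  P*R zero    = *-identityˡ 1#
  P*R (suc a) = trans (*-interchange _ _ _ _)
    (trans (*-cong (P*R a) (u*v a)) (*-identityˡ 1#))

  pow-+ : ∀ x a b → pow x (a ℕ.+ b) ≈ pow x a * pow x b
  pow-+ x zero    b = sym (*-identityˡ _)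
  pow-+ x (suc a) b = trans (*-congˡ (pow-+ x a b)) (sym (*-assoc _ _ _))

  pow-* : ∀ x y n → pow (x * y) n ≈ pow x n * pow y n
  pow-* x y zero    = sym (*-identityˡ 1#)
  pow-* x y (suc n) = trans (*-congˡ (pow-* x y n)) (*-interchange _ _ _ _)

  pow-1 : ∀ n → pow 1# n ≈ 1#
  pow-1 zero    = refl
  pow-1 (suc n) = trans (*-identityˡ _) (pow-1 n)

  u+q^ : ∀ a → u a + pow q a ≈ 1#
  u+q^ a = trans (+-assoc _ _ _) (trans (+-congˡ (-‿inverseˡ _)) (+-identityʳ 1#))

  u0≈0 : u 0 ≈ 0#
  u0≈0 = -‿inverseʳ 1#

  u-+ : ∀ a b → u (a ℕ.+ b) ≈ u a + pow q a * u b
  u-+ a b = begin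
    1# - pow q (a ℕ.+ b)            ≈⟨ +-congˡ (-‿cong (pow-+ q a b)) ⟩
    1# - A * B                      ≈⟨ +-congʳ (u+q^ a) ⟨
    u a + A - A * B                 ≈⟨ +-assoc _ _ _ ⟩
    u a + (A - A * B)               ≈⟨ +-congˡ (+-cong (*-identityʳ A) (sym (-‿distribʳ-* A B))) ⟨
    u a + (A * 1# + A * - B)        ≈⟨ +-congˡ (distribˡ A 1# (- B)) ⟨
    u a + A * u b                   ∎
    where
    A = pow q a
    B = pow q b

  -- With s = k + j + z + 1 and t = j + 1, this is a q-analogue of (s + t)(t + z) = s z + (s + t +
  -- z) t. All arguments are sums of s, t and z, so `u-+` turns the claim into a polynomial
  -- identity.
  lhs-identity : ∀ k j z →
    u (suc (suc (k ℕ.+ (j ℕ.+ z) ℕ.+ j))) * u (suc (j ℕ.+ z))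
      ≈ pow q (suc j) * u (suc (k ℕ.+ (j ℕ.+ z))) * u z
        + u (suc (suc (k ℕ.+ ((j ℕ.+ z) ℕ.+ (j ℕ.+ z))))) * u (suc j)
  lhs-identity k j z = begin
    u (suc (suc (k ℕ.+ (j ℕ.+ z) ℕ.+ j))) * u (suc (j ℕ.+ z))
      ≈⟨ *-cong (trans (u≡ (eq₁ k j z)) (u-+ (suc j) (suc (k ℕ.+ (j ℕ.+ z))))) (u-+ (suc j) z) ⟩
    (B + J * W) * (B + J * A)
      ≈⟨ Semiring.solve 4 (λ A B J W →
           (B :+ J :* W) :* (B :+ J :* A)
             := B :* B :+ J :* A :* B :+ J :* W :* B :+ J :* (J :* W :* A))
           refl A B J W ⟩
    B * B + J * A * B + J * W * B + J * (J * W * A)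
      -- The solver works in semirings, without subtraction; the relation between `u a` and
      -- `pow q a` enters as a factor 1, inserted here for `z` and removed below for `suc j`.
      ≈⟨ +-congʳ (+-congˡ (trans (*-congʳ (u+q^ z)) (*-identityˡ _))) ⟨
    B * B + J * A * B + (A + Z) * (J * W * B) + J * (J * W * A)
      ≈⟨ Semiring.solve 5 (λ A B J W Z →
           B :* B :+ J :* A :* B :+ (A :+ Z) :* (J :* W :* B) :+ J :* (J :* W :* A)
             := (B :+ J) :* (J :* W :* A) :+ (B :+ J :* A :+ J :* Z :* W) :* B)
           refl A B J W Z ⟩
    (B + J) * (J * W * A) + (B + J * A + J * Z * W) * B
      ≈⟨ +-congʳ (trans (*-congʳ (u+q^ (suc j))) (*-identityˡ _)) ⟩
    J * W * A + (B + J * A + J * Z * W) * B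
      ≈⟨ +-congˡ (*-congʳ (sym (begin
           u (suc (suc (k ℕ.+ ((j ℕ.+ z) ℕ.+ (j ℕ.+ z)))))
             ≈⟨ u≡ (eq₂ k j z) ⟩
           u ((suc j ℕ.+ z) ℕ.+ suc (k ℕ.+ (j ℕ.+ z)))
             ≈⟨ u-+ (suc j ℕ.+ z) (suc (k ℕ.+ (j ℕ.+ z))) ⟩
           u (suc j ℕ.+ z) + pow q (suc j ℕ.+ z) * W
             ≈⟨ +-cong (u-+ (suc j) z) (*-congʳ (pow-+ q (suc j) z)) ⟩
           B + J * A + J * Z * W ∎))) ⟩
    J * W * A + u (suc (suc (k ℕ.+ ((j ℕ.+ z) ℕ.+ (j ℕ.+ z))))) * B ∎
    where
    open Semiring using (_:+_; _:*_; _:=_)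
    A = u z
    B = u (suc j)
    J = pow q (suc j)
    W = u (suc (k ℕ.+ (j ℕ.+ z)))
    Z = pow q z

    eq₁ : ∀ k j z → suc (suc (k ℕ.+ (j ℕ.+ z) ℕ.+ j)) ≡ suc j ℕ.+ suc (k ℕ.+ (j ℕ.+ z))
    eq₁ = solve-∀

    eq₂ : ∀ k j z → suc (suc (k ℕ.+ ((j ℕ.+ z) ℕ.+ (j ℕ.+ z))))
                  ≡ (suc j ℕ.+ z) ℕ.+ suc (k ℕ.+ (j ℕ.+ z))
    eq₂ = solve-∀

  -- With s = i + 1 and t = k + i + 2, this is a q-analogue of (z + s)(z + t) = z (z + s + t) + s t.
  rhs-identity : ∀ k i z →
    u (suc (i ℕ.+ z)) * u (suc (suc (i ℕ.+ z ℕ.+ k)))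
      ≈ u z * u (suc (suc (suc (i ℕ.+ z ℕ.+ k ℕ.+ i))))
        + pow q z * (u (suc i) * u (suc (suc (k ℕ.+ i))))
  rhs-identity k i z = begin
    u (suc (i ℕ.+ z)) * u (suc (suc (i ℕ.+ z ℕ.+ k)))
      ≈⟨ *-cong (trans (u≡ (eq₁ i z)) (u-+ z (suc i))) (trans (u≡ (eq₂ i z k)) (u-+ z _)) ⟩
    (A + Z * B) * (A + Z * D)
      ≈⟨ Semiring.solve 4 (λ A B D Z →
           (A :+ Z :* B) :* (A :+ Z :* D)
             := A :* A :+ A :* Z :* B :+ A :* Z :* D :+ Z :* Z :* B :* D)
           refl A B D Z ⟩
    A * A + A * Z * B + A * Z * D + Z * Z * B * D
      ≈⟨ +-congʳ (+-congˡ (trans (*-congʳ (u+q^ (suc i))) (*-identityˡ _))) ⟨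
    A * A + A * Z * B + (B + I) * (A * Z * D) + Z * Z * B * D
      ≈⟨ Semiring.solve 5 (λ A B D Z I →
           A :* A :+ A :* Z :* B :+ (B :+ I) :* (A :* Z :* D) :+ Z :* Z :* B :* D
             := A :* (A :+ Z :* (B :+ I :* D)) :+ (A :+ Z) :* (Z :* (B :* D)))
           refl A B D Z I ⟩
    A * (A + Z * (B + I * D)) + (A + Z) * (Z * (B * D))
      ≈⟨ +-cong (*-congˡ (begin
           u (suc (suc (suc (i ℕ.+ z ℕ.+ k ℕ.+ i))))
             ≈⟨ u≡ (eq₃ i z k) ⟩
           u (z ℕ.+ (suc i ℕ.+ suc (suc (k ℕ.+ i))))
             ≈⟨ u-+ z _ ⟩
           A + Z * u (suc i ℕ.+ suc (suc (k ℕ.+ i)))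
             ≈⟨ +-congˡ (*-congˡ (u-+ (suc i) _)) ⟩
           A + Z * (B + I * D) ∎))
           (sym (trans (*-congʳ (u+q^ z)) (*-identityˡ _))) ⟨
    A * u (suc (suc (suc (i ℕ.+ z ℕ.+ k ℕ.+ i)))) + Z * (B * D) ∎
    where
    open Semiring using (_:+_; _:*_; _:=_)
    A = u z
    B = u (suc i)
    D = u (suc (suc (k ℕ.+ i)))
    I = pow q (suc i)
    Z = pow q z

    eq₁ : ∀ i z → suc (i ℕ.+ z) ≡ z ℕ.+ suc i
    eq₁ = solve-∀

    eq₂ : ∀ i z k → suc (suc (i ℕ.+ z ℕ.+ k)) ≡ z ℕ.+ suc (suc (k ℕ.+ i))
    eq₂ = solve-∀

    eq₃ : ∀ i z k → suc (suc (suc (i ℕ.+ z ℕ.+ k ℕ.+ i))) ≡ z ℕ.+ (suc i ℕ.+ suc (suc (k ℕ.+ i)))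
    eq₃ = solve-∀

  -- Truncated differences of indices.

  -- shift f a b is f (a - b), extended by 0 to a < b.
  shift : (ℕ → Carrier) → ℕ → ℕ → Carrier
  shift f a       zero    = f a
  shift f zero    (suc b) = 0#
  shift f (suc a) (suc b) = shift f a b

  shift-≥ : ∀ f b z → shift f (b ℕ.+ z) b ≡ f z
  shift-≥ f zero    z = ≡.refl
  shift-≥ f (suc b) z = shift-≥ f b z

  -- The result stops at `shift f z 1` instead of splitting on `z`: the border case z = 0 is left to
  -- `weightˡ-shift` and `weightʳ-shift`.
  shift-≥-suc : ∀ f b z → shift f (b ℕ.+ z) (suc b) ≡ shift f z 1
  shift-≥-suc f zero    z = ≡.refl
  shift-≥-suc f (suc b) z = shift-≥-suc f b z

  shift-< : ∀ f {a b} → a < b → shift f a b ≡ 0#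
  shift-< f {zero}  {suc b} _           = ≡.refl
  shift-< f {suc a} {suc b} (ℕ.s≤s a<b) = shift-< f a<b

  data Comparison : ℕ → ℕ → Set where
    at-least : ∀ b z → Comparison (b ℕ.+ z) b
    below    : ∀ {a b} → a < b → Comparison a b

  compare : ∀ a b → Comparison a b
  compare a       zero    = at-least 0 a
  compare zero    (suc b) = below (ℕ.s≤s ℕ.z≤n)
  compare (suc a) (suc b) with compare a b
  ... | at-least .b z = at-least (suc b) z
  ... | below a<b     = below (ℕ.s≤s a<b)

  xyz≈0 : ∀ {x y} z → y ≈ 0# → x * y * z ≈ 0#
  xyz≈0 z e = trans (*-congʳ (trans (*-congˡ e) (zeroʳ _))) (zeroˡ z)

  -- Elimination in the left matrix.

  -- The q-power and the denominator of the left entries that depend on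
  -- z = i - j + m.
  weightˡ : ℕ → Carrier
  weightˡ z = pow q (z C 2) * R z

  suc-C2 : ∀ z → suc z C 2 ≡ z ℕ.+ z C 2
  suc-C2 z = ≡.trans (≡.sym (nCk+nC[k+1]≡[n+1]C[k+1] z 1)) (≡.cong (ℕ._+ z C 2) (nC1≡n z))

  weightˡ-suc : ∀ z → weightˡ (suc z) ≈ pow q z * v (suc z) * weightˡ z
  weightˡ-suc z = begin
    pow q (suc z C 2) * (R z * v (suc z))
      ≈⟨ *-congʳ (trans (reflexive (≡.cong (pow q) (suc-C2 z))) (pow-+ q z (z C 2))) ⟩
    pow q z * pow q (z C 2) * (R z * v (suc z))
      ≈⟨ solve 4 (λ a b r v → a · b · (r · v) ⊜ a · v · (b · r)) refl _ _ _ _ ⟩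
    pow q z * v (suc z) * weightˡ z ∎

  -- Here the truncation meets the recurrence: at z = 0 the left side is 0 by `shift`, the right
  -- side because `u 0` is 0. Powers of q stand on both sides so that q is never inverted.
  weightˡ-shift : ∀ z → pow q z * shift weightˡ z 1 ≈ q * u z * weightˡ z
  weightˡ-shift zero    = trans (zeroʳ _) (sym (xyz≈0 (weightˡ 0) u0≈0))
  weightˡ-shift (suc z) = begin
    q * pow q z * weightˡ z
      ≈⟨ *-cancel _ (u*v z) ⟨
    u (suc z) * v (suc z) * (q * pow q z * weightˡ z)
      ≈⟨ solve 5 (λ u v q p w → u · v · (q · p · w) ⊜ q · u · (p · v · w)) refl _ _ _ _ _ ⟩
    q * u (suc z) * (pow q z * v (suc z) * weightˡ z)
      ≈⟨ *-congˡ (weightˡ-suc z) ⟨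
    q * u (suc z) * weightˡ (suc z) ∎

  -- The entry (i, j) of the left matrix is entryˡ k (i + m) j.
  entryˡ : ℕ → ℕ → ℕ → Carrier
  entryˡ k a j = P (k ℕ.+ a ℕ.+ j) * shift weightˡ a j * R (k ℕ.+ (j ℕ.+ j))

  -- `stepˡ k a` is the ratio of consecutive entries in column 0. The last term of `lhs-identity`
  -- has one factor depending on a = j + z only and one depending on j only; with the matching
  -- inverses they become `rowˡ` and `columnˡ`.
  stepˡ rowˡ : ℕ → ℕ → Carrier
  stepˡ k a = pow q a * u (suc (k ℕ.+ a)) * v (suc a)
  rowˡ  k a = u (suc (suc (k ℕ.+ (a ℕ.+ a)))) * v (suc a)

  columnˡ : ℕ → ℕ → Carrier
  columnˡ k j = u (suc j) * v (suc (suc (k ℕ.+ (j ℕ.+ j))))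

  entryˡ-first : ∀ k a → entryˡ k (suc a) 0 ≈ stepˡ k a * entryˡ k a 0
  entryˡ-first k a = begin
    P (k ℕ.+ suc a ℕ.+ 0) * weightˡ (suc a) * ρ
      ≈⟨ *-congʳ (*-cong (P≡ (≡.trans (ℕ.+-identityʳ _) (ℕ.+-suc k a))) (weightˡ-suc a)) ⟩
    P (k ℕ.+ a) * u (suc (k ℕ.+ a)) * (pow q a * v (suc a) * weightˡ a) * ρ
      ≈⟨ solve 6 (λ p u a v w r → p · u · (a · v · w) · r ⊜ a · u · v · (p · w · r))
           refl _ _ _ _ _ _ ⟩
    stepˡ k a * (P (k ℕ.+ a) * weightˡ a * ρ)
      ≈⟨ *-congˡ (*-congʳ (*-congʳ (P≡ (ℕ.+-identityʳ (k ℕ.+ a))))) ⟨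
    stepˡ k a * entryˡ k a 0 ∎
    where
    ρ = R (k ℕ.+ 0)

  -- For a < j all three entries vanish. Otherwise, with z = a - j and the common factors pulled
  -- out, this is `lhs-identity`; its `u z` changes the weight at z into that at z - 1, as the next
  -- column requires.
  entryˡ-rest : ∀ k a j → entryˡ k (suc a) (suc j)
    ≈ stepˡ k a * entryˡ k a (suc j) + rowˡ k a * columnˡ k j * entryˡ (suc k) a j
  entryˡ-rest k a j with compare a j
  ... | below a<j = trans (xyz≈0 _ shift≈0) (sym (trans
          (+-cong (trans (*-congˡ (xyz≈0 _ shift-suc≈0)) (zeroʳ _))
                  (trans (*-congˡ (xyz≈0 _ shift≈0)) (zeroʳ _)))
          (+-identityˡ 0#)))
    where
    shift≈0 : shift weightˡ a j ≈ 0#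
    shift≈0 = reflexive (shift-< weightˡ a<j)

    shift-suc≈0 : shift weightˡ a (suc j) ≈ 0#
    shift-suc≈0 = reflexive (shift-< weightˡ (ℕ.m<n⇒m<1+n a<j))
  ... | at-least .j z = begin
    P (k ℕ.+ suc a′ ℕ.+ suc j) * shift weightˡ a′ j * R (k ℕ.+ (suc j ℕ.+ suc j))
      ≈⟨ *-cong (*-cong (P≡ (eq₁ k a′ j)) shift≈G) (R≡ (eq₂ k j)) ⟩
    -- The identity needs a factor `u (suc a′)`; the inverse `V` inserted with it ends up in `stepˡ`
    -- and `rowˡ`.
    p * U * G * (ρ * w)
      ≈⟨ *-cancel _ (u*v a′) ⟨
    u (suc a′) * V * (p * U * G * (ρ * w))
      ≈⟨ solve 7 (λ u V p U G r w → u · V · (p · U · G · (r · w)) ⊜ p · G · r · w · V · (U · u))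
           refl _ _ _ _ _ _ _ ⟩
    p * G * ρ * w * V * (U * u (suc a′))
      ≈⟨ *-congˡ (lhs-identity k j z) ⟩
    p * G * ρ * w * V * (q * pow q j * X * u z + Y * u (suc j))
      ≈⟨ distribˡ _ _ _ ⟩
    p * G * ρ * w * V * (q * pow q j * X * u z) + p * G * ρ * w * V * (Y * u (suc j))
      ≈⟨ +-cong
           (solve 9 (λ p G r w V q J X A →
              p · G · r · w · V · (q · J · X · A) ⊜ (q · A · G) · (J · X · V · (p · (r · w))))
              refl _ _ _ _ _ _ _ _ _)
           (solve 7 (λ p G r w V Y B →
              p · G · r · w · V · (Y · B) ⊜ Y · V · (B · w) · (p · G · r))
              refl _ _ _ _ _ _ _) ⟩
    q * u z * G * (pow q j * X * V * (p * (ρ * w))) + Y * V * (u (suc j) * w) * (p * G * ρ)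
      ≈⟨ +-cong (*-congʳ (weightˡ-shift z)) (*-congˡ (*-congʳ (*-congˡ shift≈G))) ⟨
    pow q z * H * (pow q j * X * V * (p * (ρ * w)))
      + Y * V * (u (suc j) * w) * entryˡ (suc k) a′ j
      ≈⟨ +-congʳ (solve 8 (λ Z H J X V p r w →
           Z · H · (J · X · V · (p · (r · w))) ⊜ J · Z · X · V · (p · H · (r · w)))
           refl _ _ _ _ _ _ _ _) ⟩
    pow q j * pow q z * X * V * (p * H * (ρ * w))
      + Y * V * (u (suc j) * w) * entryˡ (suc k) a′ j
      ≈⟨ +-congʳ (*-cong (*-congʳ (*-congʳ (sym (pow-+ q j z))))
           (*-cong (*-cong (P≡ (≡.sym (ℕ.+-suc (k ℕ.+ a′) j)))
                           (reflexive (≡.sym (shift-≥-suc weightˡ j z))))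
                   (R≡ (≡.sym (eq₂ k j))))) ⟩
    stepˡ k a′ * entryˡ k a′ (suc j) + rowˡ k a′ * columnˡ k j * entryˡ (suc k) a′ j ∎
    where
    a′ = j ℕ.+ z
    p = P (suc (k ℕ.+ a′ ℕ.+ j))
    U = u (suc (suc (k ℕ.+ a′ ℕ.+ j)))
    G = weightˡ z
    H = shift weightˡ z 1
    ρ = R (suc (k ℕ.+ (j ℕ.+ j)))
    w = v (suc (suc (k ℕ.+ (j ℕ.+ j))))
    V = v (suc a′)
    X = u (suc (k ℕ.+ a′))
    Y = u (suc (suc (k ℕ.+ (a′ ℕ.+ a′))))

    shift≈G : shift weightˡ a′ j ≈ G
    shift≈G = reflexive (shift-≥ weightˡ j z)

    eq₁ : ∀ k a j → k ℕ.+ suc a ℕ.+ suc j ≡ suc (suc (k ℕ.+ a ℕ.+ j))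
    eq₁ = solve-∀

    eq₂ : ∀ k j → k ℕ.+ (suc j ℕ.+ suc j) ≡ suc (suc (k ℕ.+ (j ℕ.+ j)))
    eq₂ = solve-∀

  -- Elimination in the right matrix.

  -- The power y^z records the factors q^(n-i+j) produced by the elimination;
  -- y = 1 gives the entries of the right matrix.
  weightʳ : Carrier → ℕ → Carrier
  weightʳ y z = pow y z * R z

  weightʳ-shift : ∀ y z → y * shift (weightʳ y) z 1 ≈ u z * weightʳ y z
  weightʳ-shift y zero    = trans (zeroʳ y) (sym (trans (*-congʳ u0≈0) (zeroˡ _)))
  weightʳ-shift y (suc z) = begin
    y * (pow y z * R z)
      ≈⟨ *-cancel _ (u*v z) ⟨
    u (suc z) * v (suc z) * (y * (pow y z * R z))
      ≈⟨ solve 5 (λ u v y p r → u · v · (y · (p · r)) ⊜ u · (y · p · (r · v)))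
           refl _ _ _ _ _ ⟩
    u (suc z) * weightʳ y (suc z) ∎

  -- The entry (i, j) of the right matrix is entryʳ 1# k (n + j) i; the elimination
  -- works on the transposed matrix.
  entryʳ : Carrier → ℕ → ℕ → ℕ → Carrier
  entryʳ y k a i =
    u (suc (k ℕ.+ (i ℕ.+ i))) * P (a ℕ.+ a ℕ.+ k) * shift (weightʳ y) a i * R (suc (a ℕ.+ k ℕ.+ i))

  -- `stepʳ y k a` is the ratio of consecutive entries in column 0. In the last term of
  -- `rhs-identity`, everything but `pow q z` depends on i only and forms `columnʳ`; the inverses
  -- inserted to apply the identity form `rowʳ`.
  stepʳ : Carrier → ℕ → ℕ → Carrier
  stepʳ y k a = y * (u (suc (a ℕ.+ a ℕ.+ k)) * u (suc (suc (a ℕ.+ a ℕ.+ k))))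
                  * (v (suc a) * v (suc (suc (a ℕ.+ k))))

  rowʳ columnʳ : ℕ → ℕ → Carrier
  rowʳ    k a = v (suc a) * v (suc (suc (a ℕ.+ k)))
  columnʳ k i = u (suc i) * u (suc (suc (k ℕ.+ i)))

  P-suc-suc : ∀ a k → P (suc a ℕ.+ suc a ℕ.+ k)
    ≈ P (a ℕ.+ a ℕ.+ k) * (u (suc (a ℕ.+ a ℕ.+ k)) * u (suc (suc (a ℕ.+ a ℕ.+ k))))
  P-suc-suc a k = trans (P≡ (eq a k)) (*-assoc _ _ _)
    where
    eq : ∀ a k → suc a ℕ.+ suc a ℕ.+ k ≡ suc (suc (a ℕ.+ a ℕ.+ k))
    eq = solve-∀

  entryʳ-first : ∀ y k a → entryʳ y k (suc a) 0 ≈ stepʳ y k a * entryʳ y k a 0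
  entryʳ-first y k a = begin
    w * P (suc a ℕ.+ suc a ℕ.+ k) * (y * pow y a * (R a * V)) * R (suc (suc a ℕ.+ k ℕ.+ 0))
      ≈⟨ *-cong (*-congʳ (*-congˡ (P-suc-suc a k)))
                (R≡ (≡.cong (λ b → suc (suc b)) (ℕ.+-identityʳ (a ℕ.+ k)))) ⟩
    w * (p * U) * (y * pow y a * (R a * V)) * (ρ * X)
      ≈⟨ solve 9 (λ w p U y Y r V ρ X →
           w · (p · U) · (y · Y · (r · V)) · (ρ · X) ⊜ y · U · (V · X) · (w · p · (Y · r) · ρ))
           refl _ _ _ _ _ _ _ _ _ ⟩
    stepʳ y k a * (w * p * (pow y a * R a) * ρ)
      ≈⟨ *-congˡ (*-congˡ (R≡ (≡.cong suc (ℕ.+-identityʳ (a ℕ.+ k))))) ⟨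
    stepʳ y k a * entryʳ y k a 0 ∎
    where
    w = u (suc (k ℕ.+ 0))
    p = P (a ℕ.+ a ℕ.+ k)
    U = u (suc (a ℕ.+ a ℕ.+ k)) * u (suc (suc (a ℕ.+ a ℕ.+ k)))
    V = v (suc a)
    X = v (suc (suc (a ℕ.+ k)))
    ρ = R (suc (a ℕ.+ k))

  -- The factor `pow q z` from `rhs-identity` joins `pow y z`, which turns `y` into `q * y`. Raising
  -- k by 2 absorbs the two factors that `P` gains from a to a + 1.
  entryʳ-rest : ∀ y k a i → entryʳ y k (suc a) (suc i)
    ≈ stepʳ y k a * entryʳ y k a (suc i)
      + rowʳ k a * columnʳ k i * entryʳ (q * y) (suc (suc k)) a i
  entryʳ-rest y k a i with compare a i
  ... | below a<i = trans (xyz≈0 _ (shift≈0 y)) (sym (trans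
          (+-cong (trans (*-congˡ (xyz≈0 _ shift-suc≈0)) (zeroʳ _))
                  (trans (*-congˡ (xyz≈0 _ (shift≈0 (q * y)))) (zeroʳ _)))
          (+-identityˡ 0#)))
    where
    shift≈0 : ∀ y → shift (weightʳ y) a i ≈ 0#
    shift≈0 y = reflexive (shift-< (weightʳ y) a<i)

    shift-suc≈0 : shift (weightʳ y) a (suc i) ≈ 0#
    shift-suc≈0 = reflexive (shift-< (weightʳ y) (ℕ.m<n⇒m<1+n a<i))
  ... | at-least .i z = begin
    u (suc (k ℕ.+ (suc i ℕ.+ suc i))) * P (suc a′ ℕ.+ suc a′ ℕ.+ k) * shift (weightʳ y) a′ i
      * R (suc (suc a′ ℕ.+ k ℕ.+ suc i))
      ≈⟨ *-cong (*-cong (*-cong (u≡ (eq₁ k i)) (P-suc-suc a′ k)) (shift≈G y)) (R≡ (eq₂ a′ k i)) ⟩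
    w * (p * U) * G * (ρ * X)
      ≈⟨ trans (*-congʳ (*-cong (u*v a′) (u*v (suc (a′ ℕ.+ k))))) (trans (*-congʳ (*-identityˡ 1#)) (*-identityˡ _)) ⟨
    (u (suc a′) * V) * (u (suc (suc (a′ ℕ.+ k))) * V′) * (w * (p * U) * G * (ρ * X))
      ≈⟨ solve 10 (λ a V b V′ w p U G ρ X →
           (a · V) · (b · V′) · (w · (p · U) · G · (ρ · X))
             ⊜ w · (p · U) · G · (ρ · X) · (V · V′) · (a · b))
           refl _ _ _ _ _ _ _ _ _ _ ⟩
    w * (p * U) * G * (ρ * X) * (V * V′) * (u (suc a′) * u (suc (suc (a′ ℕ.+ k))))
      ≈⟨ *-congˡ (rhs-identity k i z) ⟩
    w * (p * U) * G * (ρ * X) * (V * V′) * (u z * Y + pow q z * T)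
      ≈⟨ distribˡ _ _ _ ⟩
    w * (p * U) * G * (ρ * X) * (V * V′) * (u z * Y)
      + w * (p * U) * G * (ρ * X) * (V * V′) * (pow q z * T)
      ≈⟨ +-cong
           (solve 9 (λ w p U G ρ X V A Y →
              w · (p · U) · G · (ρ · X) · V · (A · Y) ⊜ Y · X · ((A · G) · (U · V · (w · p · ρ))))
              refl _ _ _ _ _ _ _ _ _)
           (solve 10 (λ w p U y r ρ X V Z T →
              w · (p · U) · (y · r) · (ρ · X) · V · (Z · T)
                ⊜ V · T · (w · (p · U) · (Z · y · r) · (ρ · X)))
              refl _ _ _ _ _ _ _ _ _ _) ⟩
    Y * X * (u z * G * (U * (V * V′) * (w * p * ρ)))
      + V * V′ * T * (w * (p * U) * (pow q z * pow y z * R z) * (ρ * X))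
      ≈⟨ +-cong
           -- `Y` cancels the last inverse `X`: in row `a′` the entry has one inverse fewer than in
           -- row `suc a′`.
           (trans (*-cancel _ (u*v (suc (suc (a′ ℕ.+ k ℕ.+ i))))) (*-congʳ (sym (weightʳ-shift y z))))
           (*-congˡ (*-cong (*-cong (*-congˡ (sym (trans (P≡ (eq₃ a′ k)) (P-suc-suc a′ k))))
             (trans (*-congʳ (sym (pow-* q y z))) (sym (shift≈G (q * y))))) (R≡ (≡.sym (eq₄ a′ k i))))) ⟩
    y * H * (U * (V * V′) * (w * p * ρ))
      + rowʳ k a′ * columnʳ k i * entryʳ (q * y) (suc (suc k)) a′ i
      ≈⟨ +-congʳ (solve 7 (λ y H U V w p ρ → y · H · (U · V · (w · p · ρ)) ⊜ y · U · V · (w · p · H · ρ))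
           refl _ _ _ _ _ _ _) ⟩
    y * U * (V * V′) * (w * p * H * ρ)
      + rowʳ k a′ * columnʳ k i * entryʳ (q * y) (suc (suc k)) a′ i
      ≈⟨ +-congʳ (*-congˡ (*-cong (*-cong (*-congʳ (u≡ (eq₁ k i)))
           (reflexive (shift-≥-suc (weightʳ y) i z))) (R≡ (≡.cong suc (ℕ.+-suc (a′ ℕ.+ k) i))))) ⟨
    stepʳ y k a′ * entryʳ y k a′ (suc i)
      + rowʳ k a′ * columnʳ k i * entryʳ (q * y) (suc (suc k)) a′ i ∎
    where
    a′ = i ℕ.+ z
    w = u (suc (suc (suc k) ℕ.+ (i ℕ.+ i)))
    p = P (a′ ℕ.+ a′ ℕ.+ k)
    U = u (suc (a′ ℕ.+ a′ ℕ.+ k)) * u (suc (suc (a′ ℕ.+ a′ ℕ.+ k)))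
    G = weightʳ y z
    H = shift (weightʳ y) z 1
    ρ = R (suc (suc (a′ ℕ.+ k ℕ.+ i)))
    X = v (suc (suc (suc (a′ ℕ.+ k ℕ.+ i))))
    Y = u (suc (suc (suc (a′ ℕ.+ k ℕ.+ i))))
    V = v (suc a′)
    V′ = v (suc (suc (a′ ℕ.+ k)))
    T = columnʳ k i

    shift≈G : ∀ y → shift (weightʳ y) a′ i ≈ weightʳ y z
    shift≈G y = reflexive (shift-≥ (weightʳ y) i z)

    eq₁ : ∀ k i → suc (k ℕ.+ (suc i ℕ.+ suc i)) ≡ suc (suc (suc k) ℕ.+ (i ℕ.+ i))
    eq₁ = solve-∀

    eq₂ : ∀ a k i → suc (suc a ℕ.+ k ℕ.+ suc i) ≡ suc (suc (suc (a ℕ.+ k ℕ.+ i)))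
    eq₂ = solve-∀

    eq₃ : ∀ a k → a ℕ.+ a ℕ.+ suc (suc k) ≡ suc a ℕ.+ suc a ℕ.+ k
    eq₃ = solve-∀

    eq₄ : ∀ a k i → suc (a ℕ.+ suc (suc k) ℕ.+ i) ≡ suc (suc (suc (a ℕ.+ k ℕ.+ i)))
    eq₄ = solve-∀

  -- Recurrences of the product and evaluation of both determinants.

  -- The j-th factor of the middle product, counted from 0, with its runs of
  -- consecutive q-integers written as quotients of q-factorials.
  factor : ℕ → ℕ → ℕ → Carrier
  factor m k j = P (j ℕ.+ j ℕ.+ k ℕ.+ (m ℕ.+ m)) * R (j ℕ.+ j ℕ.+ k) * (P j * R (j ℕ.+ m))
    * (P (j ℕ.+ k ℕ.+ m) * R (j ℕ.+ k ℕ.+ (m ℕ.+ m)))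

  factor-suc : ∀ m k n →
    factor m k (suc n) ≈ rowˡ k (n ℕ.+ m) * columnˡ k n * factor m (suc k) n
  factor-suc m k n = begin
    factor m k (suc n)
      ≈⟨ *-cong (*-congʳ (*-cong (P≡ (eq₁ n k m)) (R≡ (eq₂ n k)))) refl ⟩
    p * U * (ρ * w) * (P n * u (suc n) * (R (n ℕ.+ m) * v (suc (n ℕ.+ m)))) * (p′ * ρ′)
      ≈⟨ solve 10 (λ p U r w a b c d e f →
           p · U · (r · w) · (a · b · (c · d)) · (e · f)
             ⊜ U · d · (b · w) · (p · r · (a · c) · (e · f)))
           refl _ _ _ _ _ _ _ _ _ _ ⟩
    U * v (suc (n ℕ.+ m)) * (u (suc n) * w) * (p * ρ * (P n * R (n ℕ.+ m)) * (p′ * ρ′))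
      ≈⟨ *-congˡ (*-cong (*-congʳ (*-cong (P≡ (eq₃ n k m)) (R≡ (eq₄ n k))))
           (*-cong (P≡ (≡.cong (ℕ._+ m) (ℕ.+-suc n k))) (R≡ (≡.cong (ℕ._+ (m ℕ.+ m)) (ℕ.+-suc n k))))) ⟨
    rowˡ k (n ℕ.+ m) * columnˡ k n * factor m (suc k) n ∎
    where
    p = P (suc (k ℕ.+ ((n ℕ.+ m) ℕ.+ (n ℕ.+ m))))
    U = u (suc (suc (k ℕ.+ ((n ℕ.+ m) ℕ.+ (n ℕ.+ m)))))
    ρ = R (suc (k ℕ.+ (n ℕ.+ n)))
    w = v (suc (suc (k ℕ.+ (n ℕ.+ n))))
    p′ = P (suc n ℕ.+ k ℕ.+ m)
    ρ′ = R (suc n ℕ.+ k ℕ.+ (m ℕ.+ m))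

    eq₁ : ∀ n k m → suc n ℕ.+ suc n ℕ.+ k ℕ.+ (m ℕ.+ m) ≡ suc (suc (k ℕ.+ ((n ℕ.+ m) ℕ.+ (n ℕ.+ m))))
    eq₁ = solve-∀

    eq₂ : ∀ n k → suc n ℕ.+ suc n ℕ.+ k ≡ suc (suc (k ℕ.+ (n ℕ.+ n)))
    eq₂ = solve-∀

    eq₃ : ∀ n k m → n ℕ.+ n ℕ.+ suc k ℕ.+ (m ℕ.+ m) ≡ suc (k ℕ.+ ((n ℕ.+ m) ℕ.+ (n ℕ.+ m)))
    eq₃ = solve-∀

    eq₄ : ∀ n k → n ℕ.+ n ℕ.+ suc k ≡ suc (k ℕ.+ (n ℕ.+ n))
    eq₄ = solve-∀

  -- By `factor-suc`, the factors from index 1 on match, one by one, the row factors, the column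
  -- factors and the product at k + 1. The constant in front is `factor m k 0`, which is the left
  -- pivot without its power of q.
  prod-factorˡ : ∀ m k n → prod (suc n) (factor m k)
    ≈ P (k ℕ.+ m) * R m * R k
      * (prod n (λ i → rowˡ k (i ℕ.+ m)) * prod n (columnˡ k) * prod n (factor m (suc k)))
  prod-factorˡ m k zero = begin
    1# * (P (k ℕ.+ (m ℕ.+ m)) * R k * (1# * R m) * (P (k ℕ.+ m) * R (k ℕ.+ (m ℕ.+ m))))
      ≈⟨ solve 5 (λ a b c d e →
           one · (a · b · (one · c) · (d · e)) ⊜ a · e · (d · c · b · (one · one · one)))
           refl _ _ _ _ _ ⟩
    P (k ℕ.+ (m ℕ.+ m)) * R (k ℕ.+ (m ℕ.+ m)) * (P (k ℕ.+ m) * R m * R k * (1# * 1# * 1#))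
      ≈⟨ *-cancel _ (P*R (k ℕ.+ (m ℕ.+ m))) ⟩
    P (k ℕ.+ m) * R m * R k * (1# * 1# * 1#) ∎
  prod-factorˡ m k (suc n) = begin
    prod (suc n) (factor m k) * factor m k (suc n)
      ≈⟨ *-cong (prod-factorˡ m k n) (factor-suc m k n) ⟩
    c₀ * (ρ * τ * φ) * (rowˡ k (n ℕ.+ m) * columnˡ k n * factor m (suc k) n)
      ≈⟨ solve 7 (λ c r t f r′ t′ f′ →
           c · (r · t · f) · (r′ · t′ · f′) ⊜ c · ((r · r′) · (t · t′) · (f · f′)))
           refl _ _ _ _ _ _ _ ⟩
    c₀ * (ρ * rowˡ k (n ℕ.+ m) * (τ * columnˡ k n) * (φ * factor m (suc k) n)) ∎
    where
    c₀ = P (k ℕ.+ m) * R m * R k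
    ρ = prod n (λ i → rowˡ k (i ℕ.+ m))
    τ = prod n (columnˡ k)
    φ = prod n (factor m (suc k))

  -- Each step keeps m, and each pivot contributes one power q^binom(m,2).
  detˡ : ∀ m k n → detℕ n (λ i j → entryˡ k (i ℕ.+ m) j)
    ≈ pow q (n ℕ.* (m C 2)) * prod n (factor m k)
  detˡ m k zero    = sym (*-identityˡ 1#)
  detˡ m k (suc n) = begin
    detℕ (suc n) (λ i j → entryˡ k (i ℕ.+ m) j)
      ≈⟨ det-eliminate n (λ i j → entryˡ k (i ℕ.+ m) j) (λ i j → entryˡ (suc k) (i ℕ.+ m) j) (λ i → stepˡ k (i ℕ.+ m))
           (λ i → rowˡ k (i ℕ.+ m)) (columnˡ k) (λ i → entryˡ-first k (i ℕ.+ m))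
           (λ i j → entryˡ-rest k (i ℕ.+ m) j) ⟩
    entryˡ k m 0 * (ρ * τ * detℕ n (λ i j → entryˡ (suc k) (i ℕ.+ m) j))
      ≈⟨ *-cong (*-cong (*-congʳ (P≡ (ℕ.+-identityʳ (k ℕ.+ m)))) (R≡ (ℕ.+-identityʳ k)))
                (*-congˡ (detˡ m (suc k) n)) ⟩
    P (k ℕ.+ m) * (pow q (m C 2) * R m) * R k * (ρ * τ * (pow q (n ℕ.* (m C 2)) * φ))
      ≈⟨ solve 8 (λ p c r s ρ τ d φ →
           p · (c · r) · s · (ρ · τ · (d · φ)) ⊜ c · d · (p · r · s · (ρ · τ · φ)))
           refl _ _ _ _ _ _ _ _ ⟩
    pow q (m C 2) * pow q (n ℕ.* (m C 2)) * (P (k ℕ.+ m) * R m * R k * (ρ * τ * φ))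
      ≈⟨ *-cong (pow-+ q (m C 2) (n ℕ.* (m C 2))) (prod-factorˡ m k n) ⟨
    pow q (suc n ℕ.* (m C 2)) * prod (suc n) (factor m k) ∎
    where
    ρ = prod n (λ i → rowˡ k (i ℕ.+ m))
    τ = prod n (columnˡ k)
    φ = prod n (factor m (suc k))

  -- Closed form of the right pivot, its power of `y` removed, times all row and column factors. The
  -- runs of row factors start at n + 1 and n + k + 2; the factorials this leaves above cancel
  -- against the `R n` and `R (suc (n + k))` of the pivot.
  cornerʳ : ℕ → ℕ → ℕ → Carrier
  cornerʳ n k m = P (n ℕ.+ n ℕ.+ k) * R k * (P m * R (n ℕ.+ m))
    * (P (suc (k ℕ.+ m)) * R (suc (n ℕ.+ k ℕ.+ m)))

  prod-rowʳ-columnʳ : ∀ n k m →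
    u (suc k) * P (n ℕ.+ n ℕ.+ k) * R n * R (suc (n ℕ.+ k))
      * (prod m (λ i → rowʳ k (n ℕ.+ i)) * prod m (columnʳ k))
      ≈ cornerʳ n k m
  prod-rowʳ-columnʳ n k zero = begin
    u (suc k) * P (n ℕ.+ n ℕ.+ k) * R n * R (suc (n ℕ.+ k)) * (1# * 1#)
      ≈⟨ *-cancel _ (P*R k) ⟨
    P k * R k * (u (suc k) * P (n ℕ.+ n ℕ.+ k) * R n * R (suc (n ℕ.+ k)) * (1# * 1#))
      ≈⟨ solve 6 (λ a b c d e f →
           a · b · (c · d · e · f · (one · one)) ⊜ d · b · (one · e) · (a · c · f))
           refl _ _ _ _ _ _ ⟩
    P (n ℕ.+ n ℕ.+ k) * R k * (1# * R n) * (P (suc k) * R (suc (n ℕ.+ k)))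
      ≈⟨ *-cong (*-congˡ (*-congˡ (R≡ (ℕ.+-identityʳ n))))
           (*-cong (P≡ (≡.cong suc (ℕ.+-identityʳ k)))
                   (R≡ (≡.cong suc (ℕ.+-identityʳ (n ℕ.+ k))))) ⟨
    cornerʳ n k 0 ∎
  prod-rowʳ-columnʳ n k (suc m) = begin
    c₀ * (ρ * (V * X) * (τ * (A * B)))
      ≈⟨ solve 7 (λ c ρ V X τ A B →
           c · (ρ · (V · X) · (τ · (A · B))) ⊜ c · (ρ · τ) · (V · X · A · B))
           refl _ _ _ _ _ _ _ ⟩
    c₀ * (ρ * τ) * (V * X * A * B)
      ≈⟨ *-congʳ (prod-rowʳ-columnʳ n k m) ⟩
    cornerʳ n k m * (V * X * A * B)
      ≈⟨ *-congʳ (*-congˡ (*-congˡ (R≡ (≡.cong suc (eq n k m))))) ⟩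
    P (n ℕ.+ n ℕ.+ k) * R k * (P m * R (n ℕ.+ m))
      * (P (suc (k ℕ.+ m)) * R (suc (n ℕ.+ m ℕ.+ k))) * (V * X * A * B)
      ≈⟨ solve 10 (λ a b c d e f V X A B →
           a · b · (c · d) · (e · f) · (V · X · A · B) ⊜ a · b · (c · A · (d · V)) · (e · B · (f · X)))
           refl _ _ _ _ _ _ _ _ _ _ ⟩
    P (n ℕ.+ n ℕ.+ k) * R k * (P (suc m) * R (suc (n ℕ.+ m)))
      * (P (suc (suc (k ℕ.+ m))) * R (suc (suc (n ℕ.+ m ℕ.+ k))))
      ≈⟨ *-cong (*-congˡ (*-congˡ (R≡ (ℕ.+-suc n m))))
           (*-cong (P≡ (≡.cong suc (ℕ.+-suc k m))) (R≡ (≡.cong suc (eq′ n k m)))) ⟨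
    cornerʳ n k (suc m) ∎
    where
    c₀ = u (suc k) * P (n ℕ.+ n ℕ.+ k) * R n * R (suc (n ℕ.+ k))
    ρ = prod m (λ i → rowʳ k (n ℕ.+ i))
    τ = prod m (columnʳ k)
    V = v (suc (n ℕ.+ m))
    X = v (suc (suc (n ℕ.+ m ℕ.+ k)))
    A = u (suc m)
    B = u (suc (suc (k ℕ.+ m)))

    eq : ∀ n k m → n ℕ.+ k ℕ.+ m ≡ n ℕ.+ m ℕ.+ k
    eq = solve-∀

    eq′ : ∀ n k m → n ℕ.+ k ℕ.+ suc m ≡ suc (n ℕ.+ m ℕ.+ k)
    eq′ = solve-∀

  -- The right elimination lowers m while the product runs over n, so two whole products are
  -- compared, by induction on n. The ratio `cornerʳ n k m` is 1 at n = 0.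
  prod-factorʳ : ∀ m k n →
    prod n (factor (suc m) k) ≈ cornerʳ n k m * prod n (factor m (suc (suc k)))
  prod-factorʳ m k zero = sym (trans (*-identityʳ _) (begin
    P k * R k * (P m * R m) * (P (suc (k ℕ.+ m)) * R (suc (k ℕ.+ m)))
      ≈⟨ *-cong (*-cong (P*R k) (P*R m)) (P*R (suc (k ℕ.+ m))) ⟩
    1# * 1# * 1#
      ≈⟨ trans (*-identityʳ _) (*-identityʳ _) ⟩
    1# ∎))
  prod-factorʳ m k (suc n) = begin
    prod n (factor (suc m) k) * factor (suc m) k n
      ≈⟨ *-cong (prod-factorʳ m k n)
           (*-cong (*-cong (*-congʳ (P≡ (eq₁ n k m))) (*-congˡ (R≡ (ℕ.+-suc n m))))
             (*-cong (P≡ (ℕ.+-suc (n ℕ.+ k) m)) (R≡ (eq₂ n k m)))) ⟩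
    p * R k * (P m * r) * (b * s) * φ * (p′ * ρ * (P n * (r * V)) * (b′ * ρ′))
      -- Of each of the three pairs inserted from here on, one half goes to `cornerʳ (suc n) k m`
      -- and the other to `factor m (suc (suc k)) n`.
      ≈⟨ *-cancel _ (u*v (suc (n ℕ.+ n ℕ.+ k))) ⟨
    B * B⁻ * (p * R k * (P m * r) * (b * s) * φ * (p′ * ρ * (P n * (r * V)) * (b′ * ρ′)))
      ≈⟨ *-cancel _ (u*v (n ℕ.+ n ℕ.+ k)) ⟨
    A * A⁻ * (B * B⁻ * (p * R k * (P m * r) * (b * s) * φ * (p′ * ρ * (P n * (r * V)) * (b′ * ρ′))))
      ≈⟨ *-cancel _ (u*v (suc (n ℕ.+ k ℕ.+ m))) ⟨
    W * W⁻ * (A * A⁻ * (B * B⁻ * (p * R k * (P m * r) * (b * s) * φ * (p′ * ρ * (P n * (r * V)) * (b′ * ρ′)))))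
      ≈⟨ solve 19 (λ W W⁻ A A⁻ B B⁻ p k m r b s φ p′ ρ n V b′ ρ′ →
           W · W⁻ · (A · A⁻ · (B · B⁻ · (p · k · (m · r) · (b · s) · φ · (p′ · ρ · (n · (r · V)) · (b′ · ρ′)))))
             ⊜ p · (A · B) · k · (m · (r · V)) · (b · (s · W⁻)) · (φ · (p′ · (ρ · A⁻ · B⁻) · (n · r) · (b′ · W · ρ′))))
           refl _ _ _ _ _ _ _ _ _ _ _ _ _ _ _ _ _ _ _ ⟩
    p * (A * B) * R k * (P m * (r * V)) * (b * (s * W⁻))
      * (φ * (p′ * (ρ * A⁻ * B⁻) * (P n * r) * (b′ * W * ρ′)))
      ≈⟨ *-cong (*-congʳ (*-congʳ (*-congʳ (P-suc-suc n k))))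
           (*-congˡ (*-cong (*-congʳ (*-congˡ (R≡ (eq₃ n k))))
             (*-cong (P≡ (eq₄ n k m)) (R≡ (eq₅ n k m))))) ⟨
    cornerʳ (suc n) k m * (φ * factor m (suc (suc k)) n) ∎
    where
    p = P (n ℕ.+ n ℕ.+ k)
    r = R (n ℕ.+ m)
    b = P (suc (k ℕ.+ m))
    s = R (suc (n ℕ.+ k ℕ.+ m))
    φ = prod n (factor m (suc (suc k)))
    p′ = P (n ℕ.+ n ℕ.+ suc (suc k) ℕ.+ (m ℕ.+ m))
    ρ = R (n ℕ.+ n ℕ.+ k)
    V = v (suc (n ℕ.+ m))
    b′ = P (suc (n ℕ.+ k ℕ.+ m))
    ρ′ = R (suc (suc (n ℕ.+ k ℕ.+ (m ℕ.+ m))))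
    A = u (suc (n ℕ.+ n ℕ.+ k))
    A⁻ = v (suc (n ℕ.+ n ℕ.+ k))
    B = u (suc (suc (n ℕ.+ n ℕ.+ k)))
    B⁻ = v (suc (suc (n ℕ.+ n ℕ.+ k)))
    W = u (suc (suc (n ℕ.+ k ℕ.+ m)))
    W⁻ = v (suc (suc (n ℕ.+ k ℕ.+ m)))

    eq₁ : ∀ n k m → n ℕ.+ n ℕ.+ k ℕ.+ (suc m ℕ.+ suc m) ≡ n ℕ.+ n ℕ.+ suc (suc k) ℕ.+ (m ℕ.+ m)
    eq₁ = solve-∀

    eq₂ : ∀ n k m → n ℕ.+ k ℕ.+ (suc m ℕ.+ suc m) ≡ suc (suc (n ℕ.+ k ℕ.+ (m ℕ.+ m)))
    eq₂ = solve-∀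

    eq₃ : ∀ n k → n ℕ.+ n ℕ.+ suc (suc k) ≡ suc (suc (n ℕ.+ n ℕ.+ k))
    eq₃ = solve-∀

    eq₄ : ∀ n k m → n ℕ.+ suc (suc k) ℕ.+ m ≡ suc (suc (n ℕ.+ k ℕ.+ m))
    eq₄ = solve-∀

    eq₅ : ∀ n k m → n ℕ.+ suc (suc k) ℕ.+ (m ℕ.+ m) ≡ suc (suc (n ℕ.+ k ℕ.+ (m ℕ.+ m)))
    eq₅ = solve-∀

  -- The parameter `y` produces the power of q: the smaller determinant contributes (q y)^(n m),
  -- which splits off q^(n m), and n m + n binom(m,2) = n binom(m+1,2).
  detʳ : ∀ n y k m → detℕ m (λ j i → entryʳ y k (n ℕ.+ j) i)
    ≈ pow y (n ℕ.* m) * (pow q (n ℕ.* (m C 2)) * prod n (factor m k))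
  detʳ n y k zero    = sym (trans (*-cong pow-zero (*-cong pow-zero (prod-one n)))
      (trans (*-identityˡ _) (*-identityˡ 1#)))
    where
    pow-zero : ∀ {x} → pow x (n ℕ.* 0) ≈ 1#
    pow-zero {x} = reflexive (≡.cong (pow x) (ℕ.*-zeroʳ n))

    factor-zero : ∀ j → factor 0 k j ≈ 1#
    factor-zero j = begin
      factor 0 k j
        ≈⟨ *-cong (*-cong (*-congʳ (P≡ (ℕ.+-identityʳ (j ℕ.+ j ℕ.+ k)))) (*-congˡ (R≡ (ℕ.+-identityʳ j))))
                  refl ⟩
      P (j ℕ.+ j ℕ.+ k) * R (j ℕ.+ j ℕ.+ k) * (P j * R j)
        * (P (j ℕ.+ k ℕ.+ 0) * R (j ℕ.+ k ℕ.+ 0))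
        ≈⟨ *-cong (*-cong (P*R (j ℕ.+ j ℕ.+ k)) (P*R j)) (P*R (j ℕ.+ k ℕ.+ 0)) ⟩
      1# * 1# * 1#
        ≈⟨ trans (*-identityʳ _) (*-identityʳ _) ⟩
      1# ∎

    prod-one : ∀ n → prod n (factor 0 k) ≈ 1#
    prod-one zero    = refl
    prod-one (suc n) = trans (*-cong (prod-one n) (factor-zero n)) (*-identityˡ 1#)
  detʳ n y k (suc m) = begin
    detℕ (suc m) (λ j i → entryʳ y k (n ℕ.+ j) i)
      ≈⟨ det-eliminate m (λ j i → entryʳ y k (n ℕ.+ j) i) (λ j i → entryʳ (q * y) (suc (suc k)) (n ℕ.+ j) i)
           (λ j → stepʳ y k (n ℕ.+ j)) (λ j → rowʳ k (n ℕ.+ j)) (columnʳ k)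
           (λ j → trans (entryʳ≡ 0 (ℕ.+-suc n j)) (entryʳ-first y k (n ℕ.+ j)))
           (λ j i → trans (entryʳ≡ (suc i) (ℕ.+-suc n j)) (entryʳ-rest y k (n ℕ.+ j) i)) ⟩
    entryʳ y k (n ℕ.+ 0) 0
      * (ρ * τ * detℕ m (λ j i → entryʳ (q * y) (suc (suc k)) (n ℕ.+ j) i))
      ≈⟨ *-cong (trans (entryʳ≡ 0 (ℕ.+-identityʳ n))
           (*-cong (*-congʳ (*-congʳ (u≡ (≡.cong suc (ℕ.+-identityʳ k)))))
             (R≡ (≡.cong suc (ℕ.+-identityʳ (n ℕ.+ k))))))
           (*-congˡ (trans (detʳ n (q * y) (suc (suc k)) m) (*-congʳ (pow-* q y (n ℕ.* m))))) ⟩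
    a * b * (pow y n * R n) * d
      * (ρ * τ * (pow q (n ℕ.* m) * pow y (n ℕ.* m) * (pow q (n ℕ.* (m C 2)) * φ)))
      ≈⟨ solve 11 (λ a b y r d ρ τ Q Y Q′ φ →
           a · b · (y · r) · d · (ρ · τ · (Q · Y · (Q′ · φ)))
             ⊜ y · Y · (Q · Q′ · (a · b · r · d · (ρ · τ) · φ)))
           refl _ _ _ _ _ _ _ _ _ _ _ ⟩
    pow y n * pow y (n ℕ.* m) * (pow q (n ℕ.* m) * pow q (n ℕ.* (m C 2))
      * (a * b * R n * d * (ρ * τ) * φ))
      ≈⟨ *-cong (sym (pow-+ y n (n ℕ.* m))) (*-cong (sym (pow-+ q (n ℕ.* m) (n ℕ.* (m C 2))))
           (trans (*-congʳ (prod-rowʳ-columnʳ n k m)) (sym (prod-factorʳ m k n)))) ⟩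
    pow y (n ℕ.+ n ℕ.* m) * (pow q (n ℕ.* m ℕ.+ n ℕ.* (m C 2)) * prod n (factor (suc m) k))
      ≈⟨ *-cong (reflexive (≡.cong (pow y) (ℕ.*-suc n m)))
           (*-congʳ (reflexive (≡.cong (pow q)
             (≡.trans (≡.cong (n ℕ.*_) (suc-C2 m)) (ℕ.*-distribˡ-+ n m (m C 2)))))) ⟨
    pow y (n ℕ.* suc m) * (pow q (n ℕ.* (suc m C 2)) * prod n (factor (suc m) k)) ∎
    where
    a = u (suc k)
    b = P (n ℕ.+ n ℕ.+ k)
    d = R (suc (n ℕ.+ k))
    ρ = prod m (λ j → rowʳ k (n ℕ.+ j))
    τ = prod m (columnʳ k)
    φ = prod n (factor m (suc (suc k)))

    entryʳ≡ : ∀ i {a b} → a ≡ b → entryʳ y k a i ≈ entryʳ y k b i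
    entryʳ≡ i e = reflexive (≡.cong (λ a → entryʳ y k a i) e)

  -- The q-integers of the middle product.

  qint⁻ : ℕ → Carrier
  qint⁻ a = v a * u 1

  w : Carrier
  w = (1# - q) ⁻¹

  u1*w : u 1 * w ≈ 1#
  u1*w = begin
    u 1 * w          ≈⟨ *-congʳ (+-congˡ (-‿cong (*-identityʳ q))) ⟩
    (1# - q) * w     ≈⟨ ⁻¹-inverse _ (λ e → unit-nonzero (u*v 0)
                          (trans (+-congˡ (-‿cong (*-identityʳ q))) e)) ⟩
    1#               ∎

  qint*qint⁻ : ∀ a → qint (suc a) * qint⁻ (suc a) ≈ 1#
  qint*qint⁻ a = begin
    u (suc a) * w * (v (suc a) * u 1)
      ≈⟨ solve 4 (λ u w v x → u · w · (v · x) ⊜ u · v · (x · w)) refl _ _ _ _ ⟩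
    u (suc a) * v (suc a) * (u 1 * w)
      ≈⟨ trans (*-cancel _ (u*v a)) u1*w ⟩
    1# ∎

  prod-qint : ∀ a n → prod n (λ l → qint (suc (a ℕ.+ l))) ≈ P (a ℕ.+ n) * R a * pow w n
  prod-qint a zero = sym (trans (*-identityʳ _) (trans (*-congʳ (P≡ (ℕ.+-identityʳ a))) (P*R a)))
  prod-qint a (suc n) = begin
    prod n (λ l → qint (suc (a ℕ.+ l))) * (u (suc (a ℕ.+ n)) * w)
      ≈⟨ *-congʳ (prod-qint a n) ⟩
    P (a ℕ.+ n) * R a * pow w n * (u (suc (a ℕ.+ n)) * w)
      ≈⟨ solve 5 (λ p r W u w → p · r · W · (u · w) ⊜ p · u · r · (w · W)) refl _ _ _ _ _ ⟩
    P (suc (a ℕ.+ n)) * R a * pow w (suc n)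
      ≈⟨ *-congʳ (*-congʳ (P≡ (ℕ.+-suc a n))) ⟨
    P (a ℕ.+ suc n) * R a * pow w (suc n) ∎

  prod-qint⁻ : ∀ a n → prod n (λ l → qint⁻ (suc (a ℕ.+ l))) ≈ R (a ℕ.+ n) * P a * pow (u 1) n
  prod-qint⁻ a zero = sym (trans (*-identityʳ _)
    (trans (*-congʳ (R≡ (ℕ.+-identityʳ a))) (trans (*-comm _ _) (P*R a))))
  prod-qint⁻ a (suc n) = begin
    prod n (λ l → qint⁻ (suc (a ℕ.+ l))) * (v (suc (a ℕ.+ n)) * u 1)
      ≈⟨ *-congʳ (prod-qint⁻ a n) ⟩
    R (a ℕ.+ n) * P a * pow (u 1) n * (v (suc (a ℕ.+ n)) * u 1)
      ≈⟨ solve 5 (λ p r W u w → p · r · W · (u · w) ⊜ p · u · r · (w · W)) refl _ _ _ _ _ ⟩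
    R (suc (a ℕ.+ n)) * P a * pow (u 1) (suc n)
      ≈⟨ *-congʳ (*-congʳ (R≡ (ℕ.+-suc a n))) ⟨
    R (a ℕ.+ suc n) * P a * pow (u 1) (suc n) ∎

  prod-⁻¹ : ∀ n (f g : ℕ → Carrier) → (∀ l → f l * g l ≈ 1#) → prod n f ⁻¹ ≈ prod n g
  prod-⁻¹ n f g e = ⁻¹-unique (inverse n)
    where
    inverse : ∀ n → prod n f * prod n g ≈ 1#
    inverse zero    = *-identityˡ 1#
    inverse (suc n) = trans (*-interchange _ _ _ _)
      (trans (*-cong (inverse n) (e n)) (*-identityˡ 1#))

  -- The 2m q-integers above and the m pairs below carry equally many factors 1 - q, which cancel;
  -- each remaining run of consecutive factors is a quotient of two factorials.
  middle-factor : ∀ m k j →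
    prod (2 ℕ.* m) (λ l → qint (2 ℕ.* suc j ℕ.∸ 1 ℕ.+ k ℕ.+ l))
      * prod m (λ l → qint (suc j ℕ.+ l) * qint (suc j ℕ.+ k ℕ.+ m ℕ.+ l)) ⁻¹
      ≈ factor m k j
  middle-factor m k j = begin
    prod (2 ℕ.* m) numerator * prod m denominator ⁻¹
      ≈⟨ *-cong
           (trans (reflexive (≡.cong (λ N → prod N numerator) (eq₀ m)))
             (trans (prod-cong (m ℕ.+ m) (λ l → reflexive (≡.cong qint (eq₁ j k l))))
               (trans (prod-qint (j ℕ.+ j ℕ.+ k) (m ℕ.+ m)) (*-congˡ (pow-+ w m m)))))
           (trans (prod-⁻¹ m denominator (λ l → qint⁻ (suc (j ℕ.+ l)) * qint⁻ (suc (j ℕ.+ k ℕ.+ m ℕ.+ l)))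
                    (λ l → trans (*-interchange _ _ _ _)
                      (trans (*-cong (qint*qint⁻ (j ℕ.+ l)) (qint*qint⁻ (j ℕ.+ k ℕ.+ m ℕ.+ l)))
                        (*-identityˡ 1#))))
             (trans (prod-* m (λ l → qint⁻ (suc (j ℕ.+ l))) (λ l → qint⁻ (suc (j ℕ.+ k ℕ.+ m ℕ.+ l))))
               (*-cong (prod-qint⁻ j m) (prod-qint⁻ (j ℕ.+ k ℕ.+ m) m)))) ⟩
    p * r * (pow w m * pow w m)
      * (R (j ℕ.+ m) * P j * pow (u 1) m * (R (j ℕ.+ k ℕ.+ m ℕ.+ m) * P (j ℕ.+ k ℕ.+ m) * pow (u 1) m))
      ≈⟨ solve 8 (λ p r w a b x c d →
           p · r · (w · w) · (a · b · x · (c · d · x))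
             ⊜ (x · w) · ((x · w) · (p · r · (b · a) · (d · c))))
           refl _ _ _ _ _ _ _ _ ⟩
    (pow (u 1) m * pow w m) * ((pow (u 1) m * pow w m)
      * (p * r * (P j * R (j ℕ.+ m)) * (P (j ℕ.+ k ℕ.+ m) * R (j ℕ.+ k ℕ.+ m ℕ.+ m))))
      ≈⟨ trans (*-cancel _ cancel) (*-cancel _ cancel) ⟩
    p * r * (P j * R (j ℕ.+ m)) * (P (j ℕ.+ k ℕ.+ m) * R (j ℕ.+ k ℕ.+ m ℕ.+ m))
      ≈⟨ *-congˡ (*-congˡ (R≡ (ℕ.+-assoc (j ℕ.+ k) m m))) ⟩
    factor m k j ∎
    where
    numerator denominator : ℕ → Carrier
    numerator   l = qint (2 ℕ.* suc j ℕ.∸ 1 ℕ.+ k ℕ.+ l)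
    denominator l = qint (suc j ℕ.+ l) * qint (suc j ℕ.+ k ℕ.+ m ℕ.+ l)

    p = P (j ℕ.+ j ℕ.+ k ℕ.+ (m ℕ.+ m))
    r = R (j ℕ.+ j ℕ.+ k)

    pow-cong : ∀ {x y} n → x ≈ y → pow x n ≈ pow y n
    pow-cong zero    e = refl
    pow-cong (suc n) e = *-cong e (pow-cong n e)

    cancel : pow (u 1) m * pow w m ≈ 1#
    cancel = trans (sym (pow-* (u 1) w m)) (trans (pow-cong m u1*w) (pow-1 m))

    eq₀ : ∀ m → 2 ℕ.* m ≡ m ℕ.+ m
    eq₀ = solve-∀

    eq₁ : ∀ j k l → j ℕ.+ suc (j ℕ.+ 0) ℕ.+ k ℕ.+ l ≡ suc (j ℕ.+ j ℕ.+ k ℕ.+ l)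
    eq₁ = solve-∀

  middle-product : ∀ n m k → middle n m k ≈ pow q (n ℕ.* (m C 2)) * prod n (factor m k)
  middle-product n m k = *-congˡ (prod-cong n (middle-factor m k))

  -- Identification of the matrix entries.

  qbinom-+ : ∀ b d → qbinom (b ℕ.+ d) (+ b) ≈ P (b ℕ.+ d) * (R b * R d)
  qbinom-+ b d with b ≤? b ℕ.+ d
  ... | yes _    = *-congˡ (⁻¹-unique (begin
    P b * P (b ℕ.+ d ℕ.∸ b) * (R b * R d)
      ≈⟨ *-congʳ (*-congˡ (P≡ (ℕ.m+n∸m≡n b d))) ⟩
    P b * P d * (R b * R d)
      ≈⟨ *-interchange _ _ _ _ ⟩
    P b * R b * (P d * R d)
      ≈⟨ trans (*-cong (P*R b) (P*R d)) (*-identityˡ 1#) ⟩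
    1# ∎))
  ... | no  b≰b+d = contradiction (ℕ.m≤m+n b d) b≰b+d

  ⊖-at-least : ∀ b z → (b ℕ.+ z) ⊖ b ≡ + z
  ⊖-at-least b z = ≡.trans (ℤ.⊖-≥ (ℕ.m≤m+n b z)) (≡.cong +_ (ℕ.m+n∸m≡n b z))

  ⊖-below : ∀ {a b} → a < b → ∃ λ d → a ⊖ b ≡ -[1+ d ]
  ⊖-below {zero}  {suc b} _           = b , ≡.refl
  ⊖-below {suc a} {suc b} (ℕ.s≤s a<b) with ⊖-below a<b
  ... | d , e = d , ≡.trans (ℤ.[1+m]⊖[1+n]≡m⊖n a b) e

  ⊖-+ : ∀ a b d → (+ a) ℤ.- (+ b) ℤ.+ (+ d) ≡ (a ℕ.+ d) ⊖ b
  ⊖-+ a b d = ≡.trans (≡.cong (ℤ._+ + d) (ℤ.m-n≡m⊖n a b))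
    (ℤ.distribˡ-⊖-+-pos d a b)

  -- The lower index a - j has the complement k + 2j in the upper index. This is free of a, which is
  -- why the last inverse in `entryˡ` depends on the column only.
  lhs-entry : ∀ k a N j → N ≡ k ℕ.+ a ℕ.+ j →
    pow q (binom2 (a ⊖ j)) * qbinom N (a ⊖ j) ≈ entryˡ k a j
  lhs-entry k a N j ≡.refl with compare a j
  ... | below a<j with ⊖-below a<j
  ...   | d , e rewrite e =
    trans (zeroʳ _) (sym (xyz≈0 _ (reflexive (shift-< weightˡ a<j))))
  lhs-entry k a N j ≡.refl | at-least .j z rewrite ⊖-at-least j z = begin
    pow q (z C 2) * qbinom (k ℕ.+ (j ℕ.+ z) ℕ.+ j) (+ z)
      ≈⟨ *-congˡ (trans (reflexive (≡.cong (λ N → qbinom N (+ z)) (eq k j z)))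
           (trans (qbinom-+ z (k ℕ.+ (j ℕ.+ j))) (*-congʳ (P≡ (≡.sym (eq k j z)))))) ⟩
    pow q (z C 2) * (P (k ℕ.+ (j ℕ.+ z) ℕ.+ j) * (R z * R (k ℕ.+ (j ℕ.+ j))))
      ≈⟨ solve 4 (λ c p r s → c · (p · (r · s)) ⊜ p · (c · r) · s) refl _ _ _ _ ⟩
    P (k ℕ.+ (j ℕ.+ z) ℕ.+ j) * weightˡ z * R (k ℕ.+ (j ℕ.+ j))
      ≈⟨ *-congʳ (*-congˡ (reflexive (shift-≥ weightˡ j z))) ⟨
    entryˡ k (j ℕ.+ z) j ∎
    where
    eq : ∀ k j z → k ℕ.+ (j ℕ.+ z) ℕ.+ j ≡ z ℕ.+ (k ℕ.+ (j ℕ.+ j))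
    eq = solve-∀

  -- With l = a - i and r = 2i + k + 1, the sum 2l + r is 2a + k + 1, free of i, and l + r is a + k
  -- + i + 1. Dividing by [2l + r] removes the last factor of its factorial and leaves
  -- `P (a + a + k)`.
  rhs-entry : ∀ k a i → qC (a ⊖ i) (2 ℕ.* i ℕ.+ k ℕ.+ 1) ≈ entryʳ 1# k a i
  rhs-entry k a i with compare a i
  ... | below a<i with ⊖-below a<i
  ...   | d , e rewrite e =
    sym (xyz≈0 _ (reflexive (shift-< (weightʳ 1#) a<i)))
  rhs-entry k a i | at-least .i z rewrite ⊖-at-least i z = begin
    qint (2 ℕ.* i ℕ.+ k ℕ.+ 1) * qint M ⁻¹ * qbinom M (+ z)
      ≈⟨ *-cong (*-cong (reflexive (≡.cong qint (eq₁ k i)))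
           (trans (reflexive (≡.cong (λ N → qint N ⁻¹) (eq₂ k i z)))
             (⁻¹-unique (qint*qint⁻ (a′ ℕ.+ a′ ℕ.+ k)))))
           (trans (reflexive (≡.cong (λ N → qbinom N (+ z)) (≡.trans (eq₂ k i z) (eq₃ k i z))))
             (trans (qbinom-+ z (suc (a′ ℕ.+ k ℕ.+ i)))
               (*-congʳ (P≡ (≡.sym (eq₃ k i z)))))) ⟩
    x * w * (v N * u 1) * (p * u N * (R z * r))
      ≈⟨ solve 8 (λ x w v y p u s r →
           x · w · (v · y) · (p · u · (s · r)) ⊜ u · v · (y · w · (x · p · s · r)))
           refl _ _ _ _ _ _ _ _ ⟩
    u N * v N * (u 1 * w * (x * p * R z * r))
      ≈⟨ trans (*-cancel _ (u*v (a′ ℕ.+ a′ ℕ.+ k))) (*-cancel _ u1*w) ⟩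
    x * p * R z * r
      ≈⟨ *-congʳ (*-congˡ (trans (reflexive (shift-≥ (weightʳ 1#) i z))
           (trans (*-congʳ (pow-1 z)) (*-identityˡ (R z))))) ⟨
    entryʳ 1# k a′ i ∎
    where
    a′ = i ℕ.+ z
    M = 2 ℕ.* z ℕ.+ (2 ℕ.* i ℕ.+ k ℕ.+ 1)
    N = suc (a′ ℕ.+ a′ ℕ.+ k)
    x = u (suc (k ℕ.+ (i ℕ.+ i)))
    p = P (a′ ℕ.+ a′ ℕ.+ k)
    r = R (suc (a′ ℕ.+ k ℕ.+ i))

    eq₁ : ∀ k i → 2 ℕ.* i ℕ.+ k ℕ.+ 1 ≡ suc (k ℕ.+ (i ℕ.+ i))
    eq₁ = solve-∀

    eq₂ : ∀ k i z → 2 ℕ.* z ℕ.+ (2 ℕ.* i ℕ.+ k ℕ.+ 1) ≡ suc ((i ℕ.+ z) ℕ.+ (i ℕ.+ z) ℕ.+ k)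
    eq₂ = solve-∀

    eq₃ : ∀ k i z → suc ((i ℕ.+ z) ℕ.+ (i ℕ.+ z) ℕ.+ k) ≡ z ℕ.+ suc ((i ℕ.+ z) ℕ.+ k ℕ.+ i)
    eq₃ = solve-∀

  -- Assembly of the two equalities.

  lhsDet≈middle : ∀ n m k → lhsDet n m k ≈ middle n m k
  lhsDet≈middle n m k = begin
    lhsDet n m k
      ≈⟨ det-cong n (λ i j → entry (toℕ i) (toℕ j)) ⟩
    detℕ n (λ i j → entryˡ k (i ℕ.+ m) j)
      ≈⟨ detˡ m k n ⟩
    pow q (n ℕ.* (m C 2)) * prod n (factor m k)
      ≈⟨ middle-product n m k ⟨
    middle n m k ∎
    where
    size : ∀ k i j m → k ℕ.+ i ℕ.+ j ℕ.+ m ≡ k ℕ.+ (i ℕ.+ m) ℕ.+ j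
    size = solve-∀

    entry : ∀ i j → pow q (binom2 ((+ i) ℤ.- (+ j) ℤ.+ (+ m)))
        * qbinom (k ℕ.+ i ℕ.+ j ℕ.+ m) ((+ i) ℤ.- (+ j) ℤ.+ (+ m))
      ≈ entryˡ k (i ℕ.+ m) j
    entry i j = trans
      (reflexive (≡.cong (λ z → pow q (binom2 z) * qbinom (k ℕ.+ i ℕ.+ j ℕ.+ m) z) (⊖-+ i j m)))
      (lhs-entry k (i ℕ.+ m) _ j (size k i j m))

  rhsDet≈middle : ∀ n m k → rhsDet n m k ≈ middle n m k
  rhsDet≈middle n m k = begin
    rhsDet n m k
      ≈⟨ det-cong m (λ i j → entry (toℕ i) (toℕ j)) ⟩
    det m (λ i j → entryʳ 1# k (n ℕ.+ toℕ j) (toℕ i))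
      ≈⟨ det-transpose m (λ j i → entryʳ 1# k (n ℕ.+ toℕ j) (toℕ i)) ⟩
    detℕ m (λ j i → entryʳ 1# k (n ℕ.+ j) i)
      ≈⟨ detʳ n 1# k m ⟩
    pow 1# (n ℕ.* m) * (pow q (n ℕ.* (m C 2)) * prod n (factor m k))
      ≈⟨ trans (*-congʳ (pow-1 (n ℕ.* m))) (*-identityˡ _) ⟩
    pow q (n ℕ.* (m C 2)) * prod n (factor m k)
      ≈⟨ middle-product n m k ⟨
    middle n m k ∎
    where
    entry : ∀ i j → qC ((+ n) ℤ.- (+ i) ℤ.+ (+ j)) (2 ℕ.* i ℕ.+ k ℕ.+ 1)
                  ≈ entryʳ 1# k (n ℕ.+ j) i
    entry i j = trans (reflexive (≡.cong (λ z → qC z (2 ℕ.* i ℕ.+ k ℕ.+ 1)) (⊖-+ n i j)))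
      (rhs-entry k (n ℕ.+ j) i)

theorem10 : ∀ {c ℓ} (F : Field c ℓ) (q : Field.Carrier F) →
    QDefs.NotRootOfUnity F q →
    ∀ (n m k : ℕ) →
    Field._≈_ F (QDefs.lhsDet F q n m k) (QDefs.middle F q n m k)
    × Field._≈_ F (QDefs.middle F q n m k) (QDefs.rhsDet F q n m k)
theorem10 F q q-generic n m k = lhsDet≈middle n m k , sym (rhsDet≈middle n m k)
  where
  open Field F using (sym)
  open Evaluation F q q-generic
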